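{- For all $n\ge1$, $$H_n\big((2^{2k}-1)B_{2k}\big)=\frac{(-1)^n}{n!(n+1)!}\cdot\mathcal{H}_n\cdot H_n\big((2^{2k+2}-1)B_{2k+2}\big),$$ where $B_j$ are the Bernoulli numbers and $\mathcal{H}_n:=\sum_{j=1}^n\frac1j$.
   Context: For a sequence $(a_k)_{k\ge 0}$ and $n\ge 0$, $H_n(a_k):=\det(a_{i+j})_{0\le i,j\le n}$ denotes the $(n+1)\times(n+1)$ Hankel determinant; in the claim the sequences are indexed by $k\ge0$. The Bernoulli numbers are defined by $\frac{t}{e^t-1}=\sum_{n\ge0}B_n\frac{t^n}{n!}$. -}

module Defs where

open import Algebra.Bundles using (CommutativeRing)
open import Data.Fin.Base using (Fin; zero; suc; toℕ)
open import Data.Integer.Base using (+_)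
import Data.Integer.Base as ℤ
import Data.Integer.Properties as ℤ
open import Data.Nat.Base as ℕ using (ℕ; zero; suc; _∸_; _!)
open import Data.Nat.Properties using (_!≢0)
open import Data.Rational.Base
open import Data.Rational.Properties
import Data.Rational.Unnormalised.Base as ℚᵘ
import Data.Rational.Unnormalised.Properties as ℚᵘ
open import Data.Vec.Functional using (Vector; []; _∷_; head; removeAt)
open import Relation.Binary.PropositionalEquality

private
  module ℚ-ring = CommutativeRing +-*-commutativeRing

open import Algebra.Properties.Semiring.Sum ℚ-ring.semiring public
  using (sum; sum-syntax; sum⁺-syntax)
open import Algebra.Properties.Semiring.Exp ℚ-ring.semiring public
  using (_^_)
open import Algebra.Properties.Semiring.Sum ℚ-ring.semiring
  using (sum-cong-≗)

------------------------------------------------------------------------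
-- Determinants

-- Cofactor expansion along the first row.
det : ∀ {n} → Vector (Vector ℚ n) n → ℚ
det {zero}  M = 1ℚ
det {suc n} M =
  ∑[ j ≤ n ] ((- 1ℚ) ^ toℕ j * M zero j * det (λ i → removeAt (M (suc i)) j))

-- The matrix has size n + 1: indices run over 0 ≤ i , j ≤ n.
hankel : ℕ → (ℕ → ℚ) → ℚ
hankel n a = det {suc n} (λ i j → a (toℕ i ℕ.+ toℕ j))

harmonic : ℕ → ℚ
harmonic n = ∑[ i < n ] (+ 1 / suc (toℕ i))

1/_! : ℕ → ℚ
1/ n ! = (+ 1 / n !) {{n !≢0}}

------------------------------------------------------------------------
-- Formal power series over ℚ, given by their coefficients

Series : Set
Series = ℕ → ℚ

infixl 7 _⊛_

_⊛_ : Series → Series → Series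
(f ⊛ g) n = ∑[ i ≤ n ] (f (toℕ i) * g (n ∸ toℕ i))

one : Series
one zero    = 1ℚ
one (suc _) = 0ℚ

t : Series
t zero    = 0ℚ
t (suc n) = one n

exp : Series
exp n = 1/ n !

exp-1 : Series
exp-1 n = exp n - one n

egf : (ℕ → ℚ) → Series
egf a n = a n * 1/ n !

-- The coefficients n , … , 1 , 0 (in this order) of the reciprocal of f, for
-- a series f with constant term 1; the constant term of f is not inspected.
recipPrefix : Series → ∀ n → Vector ℚ (suc n)
recipPrefix f zero    = 1ℚ ∷ []
recipPrefix f (suc n) =
  (- (∑[ i ≤ n ] (f (suc (toℕ i)) * recipPrefix f n i))) ∷ recipPrefix f n

recip : Series → Series
recip f n = head (recipPrefix f n)

recipPrefix-recip : ∀ f n i → recipPrefix f n i ≡ recip f (n ∸ toℕ i)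
recipPrefix-recip f zero    zero    = refl
recipPrefix-recip f (suc n) zero    = refl
recipPrefix-recip f (suc n) (suc i) = recipPrefix-recip f n i

⊛-recip : ∀ f → f 0 ≡ 1ℚ → f ⊛ recip f ≗ one
⊛-recip f f0 zero rewrite f0 = refl
⊛-recip f f0 (suc n) = begin
  f 0 * - S + S′   ≡⟨ cong₂ _+_ (cong (_* - S) f0) (sum-cong-≗ eq) ⟩
  1ℚ * - S + S     ≡⟨ cong (_+ S) (*-identityˡ (- S)) ⟩
  - S + S          ≡⟨ +-inverseˡ S ⟩
  0ℚ               ∎
  where
  open ≡-Reasoning
  S  = ∑[ i ≤ n ] (f (suc (toℕ i)) * recipPrefix f n i)
  S′ = ∑[ i ≤ n ] (f (suc (toℕ i)) * recip f (n ∸ toℕ i))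
  eq : ∀ i → f (suc (toℕ i)) * recip f (n ∸ toℕ i)
           ≡ f (suc (toℕ i)) * recipPrefix f n i
  eq i = cong (f (suc (toℕ i)) *_) (sym (recipPrefix-recip f n i))

------------------------------------------------------------------------
-- Bernoulli numbers

[exp-1]/t : Series
[exp-1]/t n = exp-1 (suc n)

-- n! times the coefficient of tⁿ in t / (eᵗ - 1); in particular
-- bernoulli 1 is - 1/2.
bernoulli : ℕ → ℚ
bernoulli n = (+ (n !) / 1) * recip [exp-1]/t n

n!*1/n! : ∀ n → (+ (n !) / 1) * 1/ n ! ≡ 1ℚ
n!*1/n! n = toℚᵘ-injective (begin
  toℚᵘ ((+ (n !) / 1) * 1/ n !)            ≈⟨ toℚᵘ-homo-* (+ (n !) / 1) (1/ n !) ⟩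
  toℚᵘ (+ (n !) / 1) ℚᵘ.* toℚᵘ (1/ n !)    ≈⟨ ℚᵘ.*-cong (toℚᵘ-fromℚᵘ′ (+ (n !)) 1) (toℚᵘ-fromℚᵘ′ (+ 1) (n !)) ⟩
  (+ (n !) ℚᵘ./ 1) ℚᵘ.* (+ 1 ℚᵘ./ n !)     ≈⟨ cancel (n !) ⟩
  ℚᵘ.1ℚᵘ                                   ∎)
  where
  open ℚᵘ.≃-Reasoning
  instance _ = n !≢0
  toℚᵘ-fromℚᵘ′ : ∀ p q .{{_ : ℕ.NonZero q}} → toℚᵘ (p / q) ℚᵘ.≃ (p ℚᵘ./ q)
  toℚᵘ-fromℚᵘ′ p (suc q) = toℚᵘ-fromℚᵘ (p ℚᵘ./ suc q)
  cancel : ∀ m .{{_ : ℕ.NonZero m}} → (+ m ℚᵘ./ 1) ℚᵘ.* (+ 1 ℚᵘ./ m) ℚᵘ.≃ ℚᵘ.1ℚᵘ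
  cancel (suc m) = ℚᵘ.*≡* (trans (ℤ.*-identityʳ _) (trans (ℤ.*-identityʳ (+ suc m))
    (sym (trans (ℤ.*-identityˡ _) (ℤ.*-identityˡ (+ suc m))))))

egf-bernoulli : egf bernoulli ≗ recip [exp-1]/t
egf-bernoulli n = begin
  a * r * b   ≡⟨ cong (_* b) (*-comm a r) ⟩
  r * a * b   ≡⟨ *-assoc r a b ⟩
  r * (a * b) ≡⟨ cong (r *_) (n!*1/n! n) ⟩
  r * 1ℚ      ≡⟨ *-identityʳ r ⟩
  r           ∎
  where
  open ≡-Reasoning
  a = + (n !) / 1
  b = 1/ n !
  r = recip [exp-1]/t n

-- The defining generating function: (eᵗ - 1) · Σ Bₙ tⁿ / n! = t.
bernoulli-gf : exp-1 ⊛ egf bernoulli ≗ t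
bernoulli-gf zero    = refl
bernoulli-gf (suc n) = begin
  exp-1 0 * egf bernoulli (suc n) + S      ≡⟨ cong (_+ S) (*-zeroˡ (egf bernoulli (suc n))) ⟩
  0ℚ + S                                   ≡⟨ +-identityˡ S ⟩
  S                                        ≡⟨ sum-cong-≗ {suc n} (λ i → cong ([exp-1]/t (toℕ i) *_) (egf-bernoulli (n ∸ toℕ i))) ⟩
  ([exp-1]/t ⊛ recip [exp-1]/t) n          ≡⟨ ⊛-recip [exp-1]/t refl n ⟩
  one n                                    ∎
  where
  open ≡-Reasoning
  S = ∑[ i ≤ n ] (exp-1 (suc (toℕ i)) * egf bernoulli (n ∸ toℕ i))

{-# OPTIONS --safe #-}

-- Read a sequence as a linear functional on polynomials. For G = Σ (2ⁿ - 1) Bₙ tⁿ / n!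
-- one has (eᵗ + 1) G = - t, i.e. the functional of (2ⁿ - 1) Bₙ sends p (x + 1) + p (x)
-- to - p′ (0). Choosing p = Π_{-k ≤ j ≤ k+1} (x - j), for which p (x + 1) + p (x) is
-- 2 Π_{0 ≤ j ≤ k} (x² - j²), evaluates the functional on φₖ₊₁, where φₖ = Π_{j<k} (x² - j²),
-- and a recurrence then evaluates it on φₘ₊₁ φₖ. The polynomial
-- pₙ = n!² Σₖ (n choose k) φₖ / k!² (a continuous dual Hahn polynomial) is monic in x²,
-- the functional kills x²ⁱ pₙ for 1 ≤ i ≤ n, and its values on pₙ and x²ⁿ⁺² pₙ are
-- ½ n!² 𝓗ₙ and ½ n!³ (n + 1)!. Replacing the last column of both Hankel matrices by the
-- one belonging to pₙ leaves a single entry there, with the same complementary minor.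
module Submission where

open import Defs
open import Algebra.Bundles using (CommutativeRing)
open import Data.Fin.Base using (Fin; zero; suc; toℕ; punchIn)
open import Data.Fin.Properties using (toℕ-fromℕ; toℕ-inject₁)
open import Data.Integer.Base as ℤ using (+_)
import Data.Integer.Properties as ℤ
open import Data.List.Base using (List; []; _∷_; _++_; _∷ʳ_; [_]; tabulate; applyUpTo; length)
open import Data.List.Properties using (++-assoc; ++-identityʳ; ∷ʳ-++; applyUpTo-∷ʳ; length-applyUpTo)
open import Data.Nat.Base as ℕ using (ℕ; zero; suc; _!; _≤_)
import Data.Nat.Properties as ℕ
open import Data.Product.Base using (∃; ∃₂; _,_; _×_)
open import Data.Rational.Base using (ℚ; 0ℚ; 1ℚ; ½; _+_; _*_; _-_; -_; _/_; toℚᵘ)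
open import Data.Rational.Properties
import Data.Rational.Unnormalised.Base as ℚᵘ
import Data.Rational.Unnormalised.Properties as ℚᵘ
open import Data.Sum.Base using (inj₁; inj₂)
open import Data.Vec.Functional using (Vector; removeAt)
open import Function.Base using (_∘_)
open import Relation.Binary.PropositionalEquality
  using (_≡_; _≗_; refl; sym; trans; cong; cong₂; subst; module ≡-Reasoning)
open import Relation.Nullary.Decidable using (dec⇒maybe)
open import Tactic.RingSolver using (solve-∀)
open import Tactic.RingSolver.Core.AlmostCommutativeRing
  using (AlmostCommutativeRing; fromCommutativeRing)

open import Algebra.Properties.Semiring.Exp (CommutativeRing.semiring +-*-commutativeRing)
  using (^-homo-*)
open import Algebra.Properties.Semiring.Sum (CommutativeRing.semiring +-*-commutativeRing)
  using (sum-cong-≗; sum-init-last; *-distribˡ-sum)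

-- Rational arithmetic

-- The coefficients of pₙ are read off from the values on φₘ₊₁ φₖ, which are ½ (-1)ᵐ⁺ᵏ (m + k)! k!
-- (m + 1)!. Weighting φₖ by (n choose k) / k!² turns the sum over k into an n-th finite difference
-- of (m + k)! / k!, a polynomial of degree m in k: it is 0 for m < n, and m = n gives the norm. On
-- pₙ itself the term k = 0 vanishes and the others give, up to the factor ½ n!², the classical sum
-- Σ (-1)ᵏ⁻¹ (n choose k) / k = 𝓗ₙ. The two Hankel matrices have the same columns, read from row 0
-- and from row 1. Columns are therefore infinite sequences and the determinant carries its starting
-- row, so that one column combination serves both; the rows 1, ..., n, where pₙ gives 0, are common
-- to both. Each determinant becomes a scalar times the same minor and only the scalars are
-- compared, so the minor is never divided by.

ring : AlmostCommutativeRing _ _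
ring = fromCommutativeRing +-*-commutativeRing (λ x → dec⇒maybe (0ℚ ≟ x))

ι : ℕ → ℚ
ι n = + n / 1

ι-+ : ∀ m n → ι (m ℕ.+ n) ≡ ι m + ι n
ι-+ m n = toℚᵘ-injective (begin
  toℚᵘ (ι (m ℕ.+ n))                        ≈⟨ toℚᵘ-fromℚᵘ (ℚᵘ.mkℚᵘ (+ (m ℕ.+ n)) 0) ⟩
  ℚᵘ.mkℚᵘ (+ (m ℕ.+ n)) 0                   ≈⟨ ℚᵘ.*≡* (cong (ℤ._* + 1) (cong₂ ℤ._+_ (sym (ℤ.*-identityʳ (+ m))) (sym (ℤ.*-identityʳ (+ n))))) ⟩
  ℚᵘ.mkℚᵘ (+ m) 0 ℚᵘ.+ ℚᵘ.mkℚᵘ (+ n) 0      ≈⟨ ℚᵘ.+-cong (toℚᵘ-fromℚᵘ (ℚᵘ.mkℚᵘ (+ m) 0)) (toℚᵘ-fromℚᵘ (ℚᵘ.mkℚᵘ (+ n) 0)) ⟨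
  toℚᵘ (ι m) ℚᵘ.+ toℚᵘ (ι n)                ≈⟨ toℚᵘ-homo-+ (ι m) (ι n) ⟨
  toℚᵘ (ι m + ι n)                          ∎)
  where open ℚᵘ.≃-Reasoning

ι-* : ∀ m n → ι (m ℕ.* n) ≡ ι m * ι n
ι-* m n = toℚᵘ-injective (begin
  toℚᵘ (ι (m ℕ.* n))                        ≈⟨ toℚᵘ-fromℚᵘ (ℚᵘ.mkℚᵘ (+ (m ℕ.* n)) 0) ⟩
  ℚᵘ.mkℚᵘ (+ (m ℕ.* n)) 0                   ≈⟨ ℚᵘ.*≡* (cong (ℤ._* + 1) (ℤ.pos-* m n)) ⟩
  ℚᵘ.mkℚᵘ (+ m) 0 ℚᵘ.* ℚᵘ.mkℚᵘ (+ n) 0      ≈⟨ ℚᵘ.*-cong (toℚᵘ-fromℚᵘ (ℚᵘ.mkℚᵘ (+ m) 0)) (toℚᵘ-fromℚᵘ (ℚᵘ.mkℚᵘ (+ n) 0)) ⟨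
  toℚᵘ (ι m) ℚᵘ.* toℚᵘ (ι n)                ≈⟨ toℚᵘ-homo-* (ι m) (ι n) ⟨
  toℚᵘ (ι m * ι n)                          ∎)
  where open ℚᵘ.≃-Reasoning

ι-suc : ∀ n → ι (suc n) ≡ 1ℚ + ι n
ι-suc = ι-+ 1

ι-inverseʳ : ∀ n → ι (suc n) * (+ 1 / suc n) ≡ 1ℚ
ι-inverseʳ n = toℚᵘ-injective (begin
  toℚᵘ (ι (suc n) * (+ 1 / suc n))                ≈⟨ toℚᵘ-homo-* (ι (suc n)) (+ 1 / suc n) ⟩
  toℚᵘ (ι (suc n)) ℚᵘ.* toℚᵘ (+ 1 / suc n)        ≈⟨ ℚᵘ.*-cong (toℚᵘ-fromℚᵘ (ℚᵘ.mkℚᵘ (+ suc n) 0)) (toℚᵘ-fromℚᵘ (ℚᵘ.mkℚᵘ (+ 1) n)) ⟩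
  ℚᵘ.mkℚᵘ (+ suc n) 0 ℚᵘ.* ℚᵘ.mkℚᵘ (+ 1) n        ≈⟨ ℚᵘ.*-inverseʳ (ℚᵘ.mkℚᵘ (+ suc n) 0) ⟩
  ℚᵘ.1ℚᵘ                                          ∎)
  where open ℚᵘ.≃-Reasoning

ι-cancelˡ : ∀ n {x y} → ι (suc n) * x ≡ ι (suc n) * y → x ≡ y
ι-cancelˡ n {x} {y} eq = trans (sym (lemma x)) (trans (cong (λ z → (+ 1 / suc n) * z) eq) (lemma y))
  where
  lemma : ∀ z → (+ 1 / suc n) * (ι (suc n) * z) ≡ z
  lemma z = trans (assoc (+ 1 / suc n) (ι (suc n)) z)
                  (trans (cong (_* z) (ι-inverseʳ n)) (*-identityˡ z))
    where
    assoc : ∀ a b c → a * (b * c) ≡ b * a * c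
    assoc = solve-∀ ring

fac : ℕ → ℚ
fac n = ι (n !)

fac-suc : ∀ n → fac (suc n) ≡ (1ℚ + ι n) * fac n
fac-suc n = trans (ι-* (suc n) (n !)) (cong (_* fac n) (ι-suc n))

1/!-suc : ∀ n → 1/ n ! ≡ (1ℚ + ι n) * 1/ suc n !
1/!-suc n = begin
  1/ n !                                          ≡⟨ *-identityʳ (1/ n !) ⟨
  1/ n ! * 1ℚ                                     ≡⟨ cong (1/ n ! *_) (n!*1/n! (suc n)) ⟨
  1/ n ! * (fac (suc n) * 1/ suc n !)             ≡⟨ cong (λ z → 1/ n ! * (z * 1/ suc n !)) (fac-suc n) ⟩
  1/ n ! * ((1ℚ + ι n) * fac n * 1/ suc n !)      ≡⟨ rearrange (1/ n !) (1ℚ + ι n) (fac n) (1/ suc n !) ⟩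
  fac n * 1/ n ! * ((1ℚ + ι n) * 1/ suc n !)      ≡⟨ cong (_* ((1ℚ + ι n) * 1/ suc n !)) (n!*1/n! n) ⟩
  1ℚ * ((1ℚ + ι n) * 1/ suc n !)                  ≡⟨ *-identityˡ _ ⟩
  (1ℚ + ι n) * 1/ suc n !                         ∎
  where
  open ≡-Reasoning
  rearrange : ∀ a b c d → a * (b * c * d) ≡ c * a * (b * d)
  rearrange = solve-∀ ring

-- Determinants by columns

-- Cofactor expansion along row r of the columns post, where pre holds the columns
-- already passed and f evaluates the minors.
expand : ℕ → (List Series → ℚ) → List Series → List Series → ℚ
expand r f pre []         = 0ℚ
expand r f pre (v ∷ post) = v r * f (pre ++ post) - expand r f (pre ∷ʳ v) post

-- detᶜ n r vs is the determinant with columns vs and rows r, …, r + n - 1; it is 0 when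
-- vs does not have length n.
detᶜ : ℕ → ℕ → List Series → ℚ
detᶜ zero    r []      = 1ℚ
detᶜ zero    r (_ ∷ _) = 0ℚ
detᶜ (suc n) r vs      = expand r (detᶜ n (suc r)) [] vs

det-cong : ∀ {n} {M N : Vector (Vector ℚ n) n} → (∀ i j → M i j ≡ N i j) → det M ≡ det N
det-cong {zero}  M≗N = refl
det-cong {suc n} M≗N = sum-cong-≗ {suc n} λ j →
  cong₂ _*_ (cong ((- 1ℚ) ^ toℕ j *_) (M≗N zero j)) (det-cong λ i k → M≗N (suc i) (punchIn j k))

-- Passing a column on to `pre` accounts for one factor -1, so the signs (-1)ʲ of the sum become the
-- nested subtractions of `expand`.
expand-tabulate : ∀ {n} r f pre (c : Vector Series (suc n)) →
  ∑[ j ≤ n ] ((- 1ℚ) ^ toℕ j * c j r * f (pre ++ tabulate (removeAt c j)))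
    ≡ expand r f pre (tabulate c)
expand-tabulate {n} r f pre c = begin
  1ℚ * c zero r * F + S
    ≡⟨ cong₂ _+_ (cong (_* F) (*-identityˡ (c zero r))) (S≡ n c) ⟩
  c zero r * F - expand r f (pre ∷ʳ c zero) (tabulate (c ∘ suc)) ∎
  where
  open ≡-Reasoning
  F = f (pre ++ tabulate (c ∘ suc))
  S = ∑[ j < n ] ((- 1ℚ) ^ toℕ (suc j) * c (suc j) r * f (pre ++ tabulate (removeAt c (suc j))))
  step : ∀ s x y → (- 1ℚ * s) * x * y ≡ - 1ℚ * (s * x * y)
  step = solve-∀ ring
  -1*x : ∀ x → - 1ℚ * x ≡ - x
  -1*x = solve-∀ ring
  S≡ : ∀ n (c : Vector Series (suc n)) →
    ∑[ j < n ] ((- 1ℚ) ^ toℕ (suc j) * c (suc j) r * f (pre ++ tabulate (removeAt c (suc j))))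
      ≡ - expand r f (pre ∷ʳ c zero) (tabulate (c ∘ suc))
  S≡ zero    c = refl
  S≡ (suc n) c = begin
    ∑[ j ≤ n ] ((- 1ℚ) ^ toℕ (suc j) * c (suc j) r * f (pre ++ tabulate (removeAt c (suc j))))
      ≡⟨ sum-cong-≗ {suc n} (λ j → trans
           (step ((- 1ℚ) ^ toℕ j) (c (suc j) r) _)
           (cong (λ l → - 1ℚ * ((- 1ℚ) ^ toℕ j * c (suc j) r * f l))
                 (sym (∷ʳ-++ pre (c zero) (tabulate (removeAt (c ∘ suc) j)))))) ⟩
    ∑[ j ≤ n ] (- 1ℚ * T j)             ≡⟨ *-distribˡ-sum (- 1ℚ) T ⟨
    - 1ℚ * ∑[ j ≤ n ] T j               ≡⟨ -1*x _ ⟩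
    - (∑[ j ≤ n ] T j)                  ≡⟨ cong -_ (expand-tabulate r f (pre ∷ʳ c zero) (c ∘ suc)) ⟩
    - expand r f (pre ∷ʳ c zero) (tabulate (c ∘ suc)) ∎
    where
    T : Fin (suc n) → ℚ
    T j = (- 1ℚ) ^ toℕ j * c (suc j) r * f ((pre ∷ʳ c zero) ++ tabulate (removeAt (c ∘ suc) j))

-- Deleting the first row only moves the starting row from r to r + 1, so the minors are again of
-- the stated form.
det≡detᶜ : ∀ n r (c : Vector Series n) →
  det (λ i j → c j (r ℕ.+ toℕ i)) ≡ detᶜ n r (tabulate c)
det≡detᶜ zero    r c = refl
det≡detᶜ (suc n) r c = begin
  det (λ i j → c j (r ℕ.+ toℕ i))
    ≡⟨ sum-cong-≗ {suc n} (λ j → cong₂ _*_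
         (cong (λ k → (- 1ℚ) ^ toℕ j * c j k) (ℕ.+-identityʳ r))
         (trans (det-cong (λ i k → cong (removeAt c j k) (ℕ.+-suc r (toℕ i))))
                (det≡detᶜ n (suc r) (removeAt c j)))) ⟩
  ∑[ j ≤ n ] ((- 1ℚ) ^ toℕ j * c j r * detᶜ n (suc r) (tabulate (removeAt c j)))
    ≡⟨ expand-tabulate r (detᶜ n (suc r)) [] c ⟩
  detᶜ (suc n) r (tabulate c) ∎
  where open ≡-Reasoning

Alternating : (List Series → ℚ) → Set
Alternating f = ∀ pre u v post → f (pre ++ u ∷ v ∷ post) ≡ - f (pre ++ v ∷ u ∷ post)

expand-swapˡ : ∀ r f → Alternating f → ∀ pre u v pre′ post →
  expand r f (pre ++ u ∷ v ∷ pre′) post ≡ - expand r f (pre ++ v ∷ u ∷ pre′) post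
expand-swapˡ r f alt pre u v pre′ []         = refl
expand-swapˡ r f alt pre u v pre′ (w ∷ post)
  rewrite ++-assoc pre (u ∷ v ∷ pre′) post | ++-assoc pre (v ∷ u ∷ pre′) post
        | ++-assoc pre (u ∷ v ∷ pre′) [ w ] | ++-assoc pre (v ∷ u ∷ pre′) [ w ]
        | expand-swapˡ r f alt pre u v (pre′ ∷ʳ w) post
        | alt pre u v (pre′ ++ post)
  = lemma (w r) _ _
  where
  lemma : ∀ w x y → w * - x - - y ≡ - (w * x - y)
  lemma = solve-∀ ring

-- Once u and v come first, their two cofactor terms trade places with opposite signs; in all later
-- terms both columns have been passed and `expand-swapˡ` applies.
expand-swapʳ : ∀ r f → Alternating f → ∀ q pre u v post →
  expand r f q (pre ++ u ∷ v ∷ post) ≡ - expand r f q (pre ++ v ∷ u ∷ post)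
expand-swapʳ r f alt q [] u v post
  rewrite ++-assoc q [ u ] post | ++-assoc q [ v ] post
        | ++-assoc q [ u ] [ v ] | ++-assoc q [ v ] [ u ]
        | expand-swapˡ r f alt q u v [] post
  = lemma (u r) (v r) _ _ _
  where
  lemma : ∀ u v x y z → u * x - (v * y - - z) ≡ - (v * y - (u * x - z))
  lemma = solve-∀ ring
expand-swapʳ r f alt q (w ∷ pre) u v post
  rewrite sym (++-assoc q pre (u ∷ v ∷ post)) | sym (++-assoc q pre (v ∷ u ∷ post))
        | alt (q ++ pre) u v post
        | expand-swapʳ r f alt (q ∷ʳ w) pre u v post
  = lemma (w r) _ _
  where
  lemma : ∀ w x y → w * - x - - y ≡ - (w * x - y)
  lemma = solve-∀ ring

detᶜ-alternating : ∀ n r → Alternating (detᶜ n r)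
detᶜ-alternating zero    r []      u v post = refl
detᶜ-alternating zero    r (_ ∷ _) u v post = refl
detᶜ-alternating (suc n) r pre u v post =
  expand-swapʳ r (detᶜ n (suc r)) (detᶜ-alternating n (suc r)) [] pre u v post

x≡-x⇒x≡0 : ∀ {x} → x ≡ - x → x ≡ 0ℚ
x≡-x⇒x≡0 {x} eq = begin
  x              ≡⟨ halves x ⟩
  ½ * (x + x)    ≡⟨ cong (λ y → ½ * (x + y)) eq ⟩
  ½ * (x + - x)  ≡⟨ zeros x ⟩
  0ℚ             ∎
  where
  open ≡-Reasoning
  halves : ∀ x → x ≡ ½ * (x + x)
  halves = solve-∀ ring
  zeros : ∀ x → ½ * (x + - x) ≡ 0ℚ
  zeros = solve-∀ ring

-- The first copy is moved right by adjacent swaps until it meets the second; swapping two equal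
-- neighbours gives x = - x.
alternating-duplicate : ∀ f → Alternating f → ∀ pre u mid post →
  f (pre ++ u ∷ mid ++ u ∷ post) ≡ 0ℚ
alternating-duplicate f alt pre u []        post = x≡-x⇒x≡0 (alt pre u u post)
alternating-duplicate f alt pre u (m ∷ mid) post = begin
  f (pre ++ u ∷ m ∷ mid ++ u ∷ post)        ≡⟨ alt pre u m (mid ++ u ∷ post) ⟩
  - f (pre ++ m ∷ u ∷ mid ++ u ∷ post)      ≡⟨ cong (λ l → - f l) (∷ʳ-++ pre m _) ⟨
  - f ((pre ∷ʳ m) ++ u ∷ mid ++ u ∷ post)   ≡⟨ cong -_ (alternating-duplicate f alt (pre ∷ʳ m) u mid post) ⟩
  - 0ℚ                                      ≡⟨⟩
  0ℚ                                        ∎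
  where open ≡-Reasoning

-- All column operations of the proof act on the last column. Since the hypothesis is pointwise, c =
-- 0 also lets a column be replaced by a pointwise equal one, without function extensionality.
detᶜ-linear : ∀ n r pre {u v w : Series} {c} → (∀ i → w i ≡ u i + c * v i) →
  detᶜ n r (pre ∷ʳ w) ≡ detᶜ n r (pre ∷ʳ u) + c * detᶜ n r (pre ∷ʳ v)
detᶜ-linear n r pre {u} {v} {w} {c} w≗ = detᶜ-lin n r pre
  where
  Linear : (List Series → ℚ) → Set
  Linear f = ∀ pre → f (pre ∷ʳ w) ≡ f (pre ∷ʳ u) + c * f (pre ∷ʳ v)
  expand-lin : ∀ r f → Linear f → ∀ q pre →
    expand r f q (pre ∷ʳ w) ≡ expand r f q (pre ∷ʳ u) + c * expand r f q (pre ∷ʳ v)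
  expand-lin r f lin q []
    rewrite w≗ r = lemma (u r) c (v r) (f (q ++ []))
    where
    lemma : ∀ u c v x → (u + c * v) * x - 0ℚ ≡ u * x - 0ℚ + c * (v * x - 0ℚ)
    lemma = solve-∀ ring
  expand-lin r f lin q (x ∷ pre)
    rewrite sym (++-assoc q pre [ w ]) | sym (++-assoc q pre [ u ]) | sym (++-assoc q pre [ v ])
          | lin (q ++ pre) | expand-lin r f lin (q ∷ʳ x) pre
    = lemma (x r) _ c _ _ _
    where
    lemma : ∀ x a c b d e → x * (a + c * b) - (d + c * e) ≡ x * a - d + c * (x * b - e)
    lemma = solve-∀ ring
  detᶜ-lin : ∀ n r → Linear (detᶜ n r)
  detᶜ-lin zero    r []      = lemma c
    where
    lemma : ∀ c → 0ℚ ≡ 0ℚ + c * 0ℚ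
    lemma = solve-∀ ring
  detᶜ-lin zero    r (_ ∷ _) = lemma c
    where
    lemma : ∀ c → 0ℚ ≡ 0ℚ + c * 0ℚ
    lemma = solve-∀ ring
  detᶜ-lin (suc n) r pre = expand-lin r (detᶜ n (suc r)) (detᶜ-lin n (suc r)) [] pre

VanishesOn : Series → ℕ → ℕ → Set
VanishesOn w r n = ∀ i → i ℕ.< n → w (r ℕ.+ i) ≡ 0ℚ

vanishes-head : ∀ {w r n} → VanishesOn w r (suc n) → w r ≡ 0ℚ
vanishes-head {w} {r} w≗0 = trans (cong w (sym (ℕ.+-identityʳ r))) (w≗0 0 ℕ.z<s)

vanishes-tail : ∀ {w r n} → VanishesOn w r (suc n) → VanishesOn w (suc r) n
vanishes-tail {w} {r} w≗0 i i<n = trans (cong w (sym (ℕ.+-suc r i))) (w≗0 (suc i) (ℕ.s<s i<n))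

detᶜ-last-corner : ∀ n r {w} → VanishesOn w r n → ∀ pre →
  detᶜ (suc n) r (pre ∷ʳ w) ≡ w (r ℕ.+ n) * detᶜ n r pre
detᶜ-last-corner zero    r {w} w≗0 [] rewrite ℕ.+-identityʳ r = lemma (w r)
  where
  lemma : ∀ x → x * 1ℚ - 0ℚ ≡ x * 1ℚ
  lemma = solve-∀ ring
-- More columns than rows: both sides are 0 by the default value of `detᶜ`.
detᶜ-last-corner zero    r {w} w≗0 (x ∷ pre) = trans (go [] x pre) (sym (*-zeroʳ (w (r ℕ.+ 0))))
  where
  nonempty : ∀ q (y : Series) pre → detᶜ 0 (suc r) (q ++ y ∷ pre) ≡ 0ℚ
  nonempty []      y pre = refl
  nonempty (_ ∷ _) y pre = refl
  lemma : ∀ x → x * 0ℚ - 0ℚ ≡ 0ℚ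
  lemma = solve-∀ ring
  go : ∀ q x pre → expand r (detᶜ 0 (suc r)) q (x ∷ pre ∷ʳ w) ≡ 0ℚ
  go q x []        rewrite nonempty q w [] | ++-identityʳ (q ∷ʳ x) | nonempty q x [] = lemma₂ (x r) (w r)
    where
    lemma₂ : ∀ x w → x * 0ℚ - (w * 0ℚ - 0ℚ) ≡ 0ℚ
    lemma₂ = solve-∀ ring
  go q x (y ∷ pre) rewrite nonempty q y (pre ∷ʳ w) | go (q ∷ʳ x) y pre = lemma (x r)
detᶜ-last-corner (suc n) r {w} w≗0 pre = go [] pre
  where
  f = detᶜ (suc n) (suc r)
  g = detᶜ n (suc r)
  f≡ : ∀ q → f (q ∷ʳ w) ≡ w (r ℕ.+ suc n) * g q
  f≡ q = trans (detᶜ-last-corner n (suc r) (vanishes-tail {w} {r} {n} w≗0) q)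
               (cong (λ k → w k * g q) (sym (ℕ.+-suc r n)))
  go : ∀ q pre → expand r f q (pre ∷ʳ w) ≡ w (r ℕ.+ suc n) * expand r g q pre
  go q [] rewrite vanishes-head {w} {r} {n} w≗0 = lemma (f (q ++ [])) (w (r ℕ.+ suc n))
    where
    lemma : ∀ x y → 0ℚ * x - 0ℚ ≡ y * 0ℚ
    lemma = solve-∀ ring
  go q (x ∷ pre)
    rewrite sym (++-assoc q pre [ w ]) | f≡ (q ++ pre) | go (q ∷ʳ x) pre
    = lemma (x r) (w (r ℕ.+ suc n)) _ _
    where
    lemma : ∀ x w y z → x * (w * y) - w * z ≡ w * (x * y - z)
    lemma = solve-∀ ring

detᶜ-last-zero : ∀ n r {w} → VanishesOn w r n → ∀ pre → detᶜ n r (pre ∷ʳ w) ≡ 0ℚ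
detᶜ-last-zero zero    r w≗0 []      = refl
detᶜ-last-zero zero    r w≗0 (_ ∷ _) = refl
detᶜ-last-zero (suc n) r {w} w≗0 pre = trans (detᶜ-last-corner n r (λ i i<n → w≗0 i (ℕ.m<n⇒m<1+n i<n)) pre)
  (trans (cong (_* detᶜ n r pre) (w≗0 n ℕ.≤-refl)) (*-zeroˡ (detᶜ n r pre)))

-- In the expansion along row r, every minor that keeps w has a zero last column. The term of w
-- itself comes after all of `pre` has been passed, whence the sign.
detᶜ-last-top : ∀ n r {w} → VanishesOn w (suc r) n → ∀ pre →
  detᶜ (suc n) r (pre ∷ʳ w) ≡ (- 1ℚ) ^ length pre * w r * detᶜ n (suc r) pre
detᶜ-last-top n r {w} w≗0 pre = go [] pre
  where
  f = detᶜ n (suc r)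
  go : ∀ q pre → expand r f q (pre ∷ʳ w) ≡ (- 1ℚ) ^ length pre * w r * f (q ++ pre)
  go q [] = lemma (w r) (f (q ++ []))
    where
    lemma : ∀ x y → x * y - 0ℚ ≡ 1ℚ * x * y
    lemma = solve-∀ ring
  go q (x ∷ pre)
    rewrite sym (++-assoc q pre [ w ]) | detᶜ-last-zero n (suc r) {w} w≗0 (q ++ pre)
          | go (q ∷ʳ x) pre | ++-assoc q [ x ] pre
    = lemma (x r) ((- 1ℚ) ^ length pre) (w r) _
    where
    lemma : ∀ x s w y → x * 0ℚ - s * w * y ≡ - 1ℚ * s * w * y
    lemma = solve-∀ ring

-- Functionals and the Bernoulli numbers

shift : Series → Series
shift a n = a (suc n)

-- A sequence a stands for the linear functional xⁿ ↦ a n on ℚ[x]; then mul c a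
-- is p ↦ a ((x - c) p), translate a is p ↦ a (p (x + 1)) and scale a is
-- p ↦ a (p (2 x)).
mul : ℚ → Series → Series
mul c a n = a (suc n) - c * a n

translate : Series → Series
translate a zero    = a 0
translate a (suc n) = translate (λ i → a i + a (suc i)) n

scale : Series → Series
scale a n = (+ 2 / 1) ^ n * a n

mul-cong : ∀ c {a b} → a ≗ b → mul c a ≗ mul c b
mul-cong c a≗b n = cong₂ (λ x y → x - c * y) (a≗b (suc n)) (a≗b n)

mul-comm : ∀ c d a → mul c (mul d a) ≗ mul d (mul c a)
mul-comm c d a n = lemma c d (a (suc (suc n))) (a (suc n)) (a n)
  where
  lemma : ∀ c d x y z → x - d * y - c * (y - d * z) ≡ x - c * y - d * (y - c * z)
  lemma = solve-∀ ring

mul-linear : ∀ d u v c {w} → (∀ i → w i ≡ u i + c * v i) →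
  ∀ i → mul d w i ≡ mul d u i + c * mul d v i
mul-linear d u v c w≗ i rewrite w≗ (suc i) | w≗ i =
  lemma d c (u (suc i)) (v (suc i)) (u i) (v i)
  where
  lemma : ∀ d c x y z t → x + c * y - d * (z + c * t) ≡ x - d * z + c * (y - d * t)
  lemma = solve-∀ ring

translate-linear : ∀ u v c {w} → (∀ i → w i ≡ u i + c * v i) →
  ∀ i → translate w i ≡ translate u i + c * translate v i
translate-linear u v c w≗ zero    = w≗ 0
translate-linear u v c w≗ (suc i) = translate-linear _ (λ j → v j + v (suc j)) c (λ j → trans
  (cong₂ _+_ (w≗ j) (w≗ (suc j))) (lemma c (u j) (v j) (u (suc j)) (v (suc j)))) i
  where
  lemma : ∀ c x y z t → x + c * y + (z + c * t) ≡ x + z + c * (y + t)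
  lemma = solve-∀ ring

translate-cong : ∀ {a b} → a ≗ b → translate a ≗ translate b
translate-cong a≗b zero    = a≗b 0
translate-cong a≗b (suc n) = translate-cong (λ i → cong₂ _+_ (a≗b i) (a≗b (suc i))) n

-- At x + 1 the factor x - c becomes x - d. The relation is a hypothesis because the roots in use,
-- such as `ι (suc k)`, do not reduce to the form d + 1.
translate-mul : ∀ {c} d a → c ≡ d + 1ℚ → translate (mul d a) ≗ mul c (translate a)
translate-mul d a refl n = trans
  (translate-linear (λ i → a i + a (suc i)) a (- (d + 1ℚ)) (λ i → lemma d (a (suc i)) (a i)) n)
  (lemma′ d (translate a (suc n)) (translate a n))
  where
  lemma : ∀ d x y → x - d * y ≡ y + x + - (d + 1ℚ) * y
  lemma = solve-∀ ring
  lemma′ : ∀ d x y → x + - (d + 1ℚ) * y ≡ x - (d + 1ℚ) * y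
  lemma′ = solve-∀ ring

-- Since 2x + 2 = 2 (x + 1), both sides are p ↦ a (p (2x + 2)).
translate²-scale : ∀ a → translate (translate (scale a)) ≗ scale (translate a)
translate²-scale a zero    = refl
translate²-scale a (suc n) = begin
  translate (λ i → translate (scale a) i + translate (scale a) (suc i)) n
    ≡⟨ translate-cong (λ i → trans (add (translate (scale a) i) _)
         (trans (sym (translate-linear (scale a) (λ j → scale a j + scale a (suc j)) 1ℚ (λ _ → refl) i)) (translate-cong eq i))) n ⟩
  translate (translate (scale b)) n
    ≡⟨ translate²-scale b n ⟩
  (+ 2 / 1) ^ n * translate b n
    ≡⟨ cong ((+ 2 / 1) ^ n *_) (translate-linear _ (λ i → a i + a (suc i)) 1ℚ (λ j → add′ (a j + a (suc j))) n) ⟩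
  (+ 2 / 1) ^ n * (T + 1ℚ * T)
    ≡⟨ lemma ((+ 2 / 1) ^ n) T ⟩
  (+ 2 / 1) * (+ 2 / 1) ^ n * T ∎
  where
  open ≡-Reasoning
  T = translate (λ i → a i + a (suc i)) n
  -- `b` is a with one factor 2 (x + 1) absorbed, which at 2x + 2 takes over one power of the
  -- monomial.
  b : Series
  b i = (a i + a (suc i)) + (a i + a (suc i))
  add : ∀ x y → x + y ≡ x + 1ℚ * y
  add = solve-∀ ring
  add′ : ∀ x → x + x ≡ x + 1ℚ * x
  add′ = solve-∀ ring
  lemma : ∀ p x → p * (x + 1ℚ * x) ≡ (+ 2 / 1) * p * x
  lemma = solve-∀ ring
  eq : ∀ i → scale a i + 1ℚ * (scale a i + scale a (suc i)) ≡ scale b i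
  eq i = lemma′ ((+ 2 / 1) ^ i) (a i) (a (suc i))
    where
    lemma′ : ∀ p x y → p * x + 1ℚ * (p * x + (+ 2 / 1) * p * y) ≡ p * (x + y + (x + y))
    lemma′ = solve-∀ ring

-- Of the binomial expansion of (x + 1)ⁿ⁺¹ only the terms xⁿ⁺¹ and (n + 1) xⁿ survive.
translate-prefix : ∀ n {h} → (∀ i → i ℕ.< n → h i ≡ 0ℚ) →
  translate h (suc n) ≡ h (suc n) + ι (suc n) * h n
translate-prefix zero    {h} h≗0 = lemma (h 0) (h 1)
  where
  lemma : ∀ x y → x + y ≡ y + 1ℚ * x
  lemma = solve-∀ ring
translate-prefix (suc n) {h} h≗0 = begin
  translate (λ i → h i + h (suc i)) (suc n)
    ≡⟨ translate-prefix n (λ i i<n → cong₂ _+_ (h≗0 i (ℕ.m<n⇒m<1+n i<n)) (h≗0 (suc i) (ℕ.s<s i<n))) ⟩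
  h (suc n) + h (suc (suc n)) + ι (suc n) * (h n + h (suc n))
    ≡⟨ cong (λ x → h (suc n) + h (suc (suc n)) + ι (suc n) * (x + h (suc n))) (h≗0 n ℕ.≤-refl) ⟩
  h (suc n) + h (suc (suc n)) + ι (suc n) * (0ℚ + h (suc n))
    ≡⟨ lemma (h (suc n)) (h (suc (suc n))) (ι (suc n)) ⟩
  h (suc (suc n)) + (1ℚ + ι (suc n)) * h (suc n)
    ≡⟨ cong (λ x → h (suc (suc n)) + x * h (suc n)) (ι-suc (suc n)) ⟨
  h (suc (suc n)) + ι (suc (suc n)) * h (suc n) ∎
  where
  open ≡-Reasoning
  lemma : ∀ x y z → x + y + z * (0ℚ + x) ≡ y + (1ℚ + z) * x
  lemma = solve-∀ ring

-- If h vanishes below n, the fixed-point equation at n + 1 reduces to (n + 1) h n = 0.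
translate-fixed⇒zero : ∀ {h} → translate h ≗ h → ∀ n → h n ≡ 0ℚ
translate-fixed⇒zero {h} fixed n = below (suc n) n ℕ.≤-refl
  where
  open ≡-Reasoning
  below : ∀ n i → i ℕ.< n → h i ≡ 0ℚ
  below (suc n) i i<1+n with ℕ.m<1+n⇒m<n∨m≡n i<1+n
  ... | inj₁ i<n  = below n i i<n
  ... | inj₂ refl = ι-cancelˡ n (begin
    ι (suc n) * h n                             ≡⟨ lemma (h (suc n)) _ ⟩
    h (suc n) + ι (suc n) * h n - h (suc n)     ≡⟨ cong (_- h (suc n)) (translate-prefix n (below n)) ⟨
    translate h (suc n) - h (suc n)             ≡⟨ cong (_- h (suc n)) (fixed (suc n)) ⟩
    h (suc n) - h (suc n)                       ≡⟨ lemma′ (h (suc n)) (ι (suc n)) ⟩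
    ι (suc n) * 0ℚ                              ∎)
    where
    lemma : ∀ x y → y ≡ x + y - x
    lemma = solve-∀ ring
    lemma′ : ∀ x y → x - x ≡ y * 0ℚ
    lemma′ = solve-∀ ring

-- Formal derivatives, and translation as multiplication by eᵗ

⊛-congˡ : ∀ {f g} → f ≗ g → ∀ h → f ⊛ h ≗ g ⊛ h
⊛-congˡ f≗g h zero    = cong (λ x → x * h 0 + 0ℚ) (f≗g 0)
⊛-congˡ f≗g h (suc n) = cong₂ _+_ (cong (_* h (suc n)) (f≗g 0)) (⊛-congˡ (λ i → f≗g (suc i)) h n)

⊛-congʳ : ∀ f {g h} → g ≗ h → f ⊛ g ≗ f ⊛ h
⊛-congʳ f g≗h zero    = cong (λ x → f 0 * x + 0ℚ) (g≗h 0)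
⊛-congʳ f g≗h (suc n) = cong₂ _+_ (cong (f 0 *_) (g≗h (suc n))) (⊛-congʳ (shift f) g≗h n)

⊛-distribʳ : ∀ f g h → (λ i → f i + g i) ⊛ h ≗ λ i → (f ⊛ h) i + (g ⊛ h) i
⊛-distribʳ f g h zero    = lemma (f 0) (g 0) (h 0)
  where
  lemma : ∀ x y z → (x + y) * z + 0ℚ ≡ x * z + 0ℚ + (y * z + 0ℚ)
  lemma = solve-∀ ring
⊛-distribʳ f g h (suc n) rewrite ⊛-distribʳ (shift f) (shift g) h n =
  lemma (f 0) (g 0) (h (suc n)) ((shift f ⊛ h) n) ((shift g ⊛ h) n)
  where
  lemma : ∀ x y z u v → (x + y) * z + (u + v) ≡ x * z + u + (y * z + v)
  lemma = solve-∀ ring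

⊛-distribˡ : ∀ f g h → f ⊛ (λ i → g i + h i) ≗ λ i → (f ⊛ g) i + (f ⊛ h) i
⊛-distribˡ f g h zero    = lemma (f 0) (g 0) (h 0)
  where
  lemma : ∀ x y z → x * (y + z) + 0ℚ ≡ x * y + 0ℚ + (x * z + 0ℚ)
  lemma = solve-∀ ring
⊛-distribˡ f g h (suc n) rewrite ⊛-distribˡ (shift f) g h n =
  lemma (f 0) (g (suc n)) (h (suc n)) ((shift f ⊛ g) n) ((shift f ⊛ h) n)
  where
  lemma : ∀ x y z u v → x * (y + z) + (u + v) ≡ x * y + u + (x * z + v)
  lemma = solve-∀ ring

one-⊛ : ∀ h → one ⊛ h ≗ h
one-⊛ h zero    = lemma (h 0)
  where
  lemma : ∀ x → 1ℚ * x + 0ℚ ≡ x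
  lemma = solve-∀ ring
one-⊛ h (suc n) = trans (cong (λ x → 1ℚ * h (suc n) + x) (zero-⊛ n)) (lemma (h (suc n)))
  where
  lemma : ∀ x → 1ℚ * x + 0ℚ ≡ x
  lemma = solve-∀ ring
  zero-⊛ : ∀ n → ((λ _ → 0ℚ) ⊛ h) n ≡ 0ℚ
  zero-⊛ zero    = cong (_+ 0ℚ) (*-zeroˡ (h 0))
  zero-⊛ (suc n) = cong₂ _+_ (*-zeroˡ (h (suc n))) (zero-⊛ n)

derivative : Series → Series
derivative f n = ι (suc n) * f (suc n)

euler : Series → Series
euler f n = ι n * f n

-- For t d/dt the weight n splits as i + (n - i) on each summand f i * h (n - i), so no index is
-- displaced; the Leibniz rule for d/dt follows by one shift. The induction uses that (f ⊛ h) (n +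
-- 1) unfolds to f 0 * h (n + 1) plus (`shift f` ⊛ h) n.
euler-⊛ : ∀ f h → euler (f ⊛ h) ≗ λ n → (euler f ⊛ h) n + (f ⊛ euler h) n
euler-⊛ f h zero    = lemma (f 0) (h 0)
  where
  lemma : ∀ x y → 0ℚ * (x * y + 0ℚ) ≡ 0ℚ * x * y + 0ℚ + (x * (0ℚ * y) + 0ℚ)
  lemma = solve-∀ ring
euler-⊛ f h (suc n) = begin
  ι (suc n) * (f 0 * h (suc n) + (shift f ⊛ h) n)
    ≡⟨ cong (_* (f 0 * h (suc n) + (shift f ⊛ h) n)) (ι-suc n) ⟩
  (1ℚ + ι n) * (f 0 * h (suc n) + (shift f ⊛ h) n)
    ≡⟨ lemma (ι n) (f 0) (h (suc n)) ((shift f ⊛ h) n) ⟩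
  0ℚ * f 0 * h (suc n) + ((shift f ⊛ h) n + ι n * (shift f ⊛ h) n) + f 0 * ((1ℚ + ι n) * h (suc n))
    ≡⟨ cong₂ (λ x y → 0ℚ * f 0 * h (suc n) + ((shift f ⊛ h) n + x) + f 0 * (y * h (suc n)))
             (euler-⊛ (shift f) h n) (sym (ι-suc n)) ⟩
  0ℚ * f 0 * h (suc n) + ((shift f ⊛ h) n + ((euler (shift f) ⊛ h) n + (shift f ⊛ euler h) n)) + f 0 * euler h (suc n)
    ≡⟨ lemma′ (0ℚ * f 0 * h (suc n)) ((shift f ⊛ h) n) ((euler (shift f) ⊛ h) n) ((shift f ⊛ euler h) n) (f 0 * euler h (suc n)) ⟩
  0ℚ * f 0 * h (suc n) + ((shift f ⊛ h) n + (euler (shift f) ⊛ h) n) + (f 0 * euler h (suc n) + (shift f ⊛ euler h) n)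
    ≡⟨ cong (λ x → 0ℚ * f 0 * h (suc n) + x + (f 0 * euler h (suc n) + (shift f ⊛ euler h) n)) eq ⟨
  0ℚ * f 0 * h (suc n) + (shift (euler f) ⊛ h) n + (f 0 * euler h (suc n) + (shift f ⊛ euler h) n) ∎
  where
  open ≡-Reasoning
  lemma : ∀ n x y z → (1ℚ + n) * (x * y + z) ≡ 0ℚ * x * y + (z + n * z) + x * ((1ℚ + n) * y)
  lemma = solve-∀ ring
  lemma′ : ∀ a b c d e → a + (b + (c + d)) + e ≡ a + (b + c) + (e + d)
  lemma′ = solve-∀ ring
  lemma″ : ∀ x y → (1ℚ + x) * y ≡ y + x * y
  lemma″ = solve-∀ ring
  eq : (shift (euler f) ⊛ h) n ≡ (shift f ⊛ h) n + (euler (shift f) ⊛ h) n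
  eq = trans (⊛-congˡ (λ i → trans (cong (_* f (suc i)) (ι-suc i)) (lemma″ (ι i) (f (suc i)))) h n)
             (⊛-distribʳ (shift f) (euler (shift f)) h n)

⊛-euler : ∀ f h n → (f ⊛ euler h) (suc n) ≡ (f ⊛ derivative h) n
⊛-euler f h zero    = lemma (f 0) (ι 1 * h 1) (f 1) (h 0)
  where
  lemma : ∀ x y z u → x * y + (z * (0ℚ * u) + 0ℚ) ≡ x * y + 0ℚ
  lemma = solve-∀ ring
⊛-euler f h (suc n) = cong (λ x → f 0 * euler h (suc (suc n)) + x) (⊛-euler (shift f) h n)

derivative-⊛ : ∀ f h → derivative (f ⊛ h) ≗ λ n → (derivative f ⊛ h) n + (f ⊛ derivative h) n
derivative-⊛ f h n = trans (euler-⊛ f h (suc n)) (cong₂ _+_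
  (lemma (f 0) (h (suc n)) ((derivative f ⊛ h) n)) (⊛-euler f h n))
  where
  lemma : ∀ x y z → 0ℚ * x * y + z ≡ z
  lemma = solve-∀ ring

derivative-exp : derivative exp ≗ exp
derivative-exp n = trans (cong (_* 1/ suc n !) (ι-suc n)) (sym (1/!-suc n))

derivative-egf : ∀ a → derivative (egf a) ≗ egf (shift a)
derivative-egf a n = trans (lemma (ι (suc n)) (a (suc n)) (1/ suc n !)) (cong (a (suc n) *_) (derivative-exp n))
  where
  lemma : ∀ x y z → x * (y * z) ≡ y * (x * z)
  lemma = solve-∀ ring

-- With A = `egf a`, the recursion of `translate` replaces A by A + A′, and (eᵗ A)′ = eᵗ (A + A′).
translate-egf : ∀ a n → translate a n ≡ fac n * (exp ⊛ egf a) n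
translate-egf a zero    = lemma (a 0)
  where
  lemma : ∀ x → x ≡ 1ℚ * (1ℚ * (x * 1ℚ) + 0ℚ)
  lemma = solve-∀ ring
translate-egf a (suc n) = begin
  translate (λ i → a i + a (suc i)) n
    ≡⟨ translate-egf (λ i → a i + a (suc i)) n ⟩
  fac n * (exp ⊛ egf (λ i → a i + a (suc i))) n
    ≡⟨ cong (fac n *_) (⊛-congʳ exp (λ i → *-distribʳ-+ (1/ i !) (a i) (a (suc i))) n) ⟩
  fac n * (exp ⊛ λ i → egf a i + egf (shift a) i) n
    ≡⟨ cong (fac n *_) (⊛-distribˡ exp (egf a) (egf (shift a)) n) ⟩
  fac n * ((exp ⊛ egf a) n + (exp ⊛ egf (shift a)) n)
    ≡⟨ cong (fac n *_) (cong₂ _+_ (⊛-congˡ derivative-exp (egf a) n) (⊛-congʳ exp (derivative-egf a) n)) ⟨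
  fac n * ((derivative exp ⊛ egf a) n + (exp ⊛ derivative (egf a)) n)
    ≡⟨ cong (fac n *_) (derivative-⊛ exp (egf a) n) ⟨
  fac n * (ι (suc n) * (exp ⊛ egf a) (suc n))
    ≡⟨ lemma (fac n) (ι (suc n)) _ ⟩
  ι (suc n) * fac n * (exp ⊛ egf a) (suc n)
    ≡⟨ cong (_* (exp ⊛ egf a) (suc n)) (ι-* (suc n) (n !)) ⟨
  fac (suc n) * (exp ⊛ egf a) (suc n) ∎
  where
  open ≡-Reasoning
  lemma : ∀ x y z → x * (y * z) ≡ y * x * z
  lemma = solve-∀ ring

-- eᵗ B = (eᵗ - 1) B + B = t + B, where B is the generating function; the factor n! does not change
-- t because 1! = 1.
translate-bernoulli : ∀ n → translate bernoulli n ≡ bernoulli n + t n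
translate-bernoulli n = begin
  translate bernoulli n
    ≡⟨ translate-egf bernoulli n ⟩
  fac n * (exp ⊛ egf bernoulli) n
    ≡⟨ cong (fac n *_) (⊛-congˡ (λ i → split (exp i) (one i)) (egf bernoulli) n) ⟩
  fac n * ((λ i → exp-1 i + one i) ⊛ egf bernoulli) n
    ≡⟨ cong (fac n *_) (⊛-distribʳ exp-1 one (egf bernoulli) n) ⟩
  fac n * ((exp-1 ⊛ egf bernoulli) n + (one ⊛ egf bernoulli) n)
    ≡⟨ cong (fac n *_) (cong₂ _+_ (bernoulli-gf n) (one-⊛ (egf bernoulli) n)) ⟩
  fac n * (t n + bernoulli n * 1/ n !)
    ≡⟨ lemma (fac n) (t n) (bernoulli n) (1/ n !) ⟩
  bernoulli n * (fac n * 1/ n !) + fac n * t n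
    ≡⟨ cong₂ _+_ (trans (cong (bernoulli n *_) (n!*1/n! n)) (*-identityʳ (bernoulli n))) (fac*t n) ⟩
  bernoulli n + t n ∎
  where
  open ≡-Reasoning
  split : ∀ x y → x ≡ x - y + y
  split = solve-∀ ring
  lemma : ∀ f t b i → f * (t + b * i) ≡ b * (f * i) + f * t
  lemma = solve-∀ ring
  fac*t : ∀ n → fac n * t n ≡ t n
  fac*t zero          = refl
  fac*t (suc zero)    = refl
  fac*t (suc (suc n)) = *-zeroʳ (fac (suc (suc n)))

-- The Genocchi numbers multiplied by -½.
genocchi : Series
genocchi n = ((+ 2 / 1) ^ n - 1ℚ) * bernoulli n

-- As a generating function: (eᵗ + 1) G = - t, where G is that of genocchi.
-- This holds after multiplication by eᵗ - 1, which translate-fixed⇒zero cancels.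
translate-genocchi : ∀ n → translate genocchi n ≡ - genocchi n - t n
translate-genocchi n = begin
  translate genocchi n
    ≡⟨ lemma (translate genocchi n) (genocchi n) (t n) ⟩
  h n - genocchi n - t n
    ≡⟨ cong (λ x → x - genocchi n - t n) (translate-fixed⇒zero h-fixed n) ⟩
  0ℚ - genocchi n - t n
    ≡⟨ cong (_- t n) (+-identityˡ (- genocchi n)) ⟩
  - genocchi n - t n ∎
  where
  open ≡-Reasoning
  lemma : ∀ x y z → x ≡ x + 1ℚ * (y + 1ℚ * z) - y - z
  lemma = solve-∀ ring
  -- The sequence of (eᵗ + 1) G + t, whose vanishing is the claim.
  h : Series
  h i = translate genocchi i + 1ℚ * (genocchi i + 1ℚ * t i)
  split : ∀ i → genocchi i ≡ scale bernoulli i + - 1ℚ * bernoulli i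
  split i = lemma′ ((+ 2 / 1) ^ i) (bernoulli i)
    where
    lemma′ : ∀ x y → (x - 1ℚ) * y ≡ x * y + - 1ℚ * y
    lemma′ = solve-∀ ring
  translateB : ∀ i → translate bernoulli i ≡ bernoulli i + 1ℚ * t i
  translateB i = trans (translate-bernoulli i) (cong (_+_ (bernoulli i)) (sym (*-identityˡ (t i))))
  scale-t : ∀ i → (+ 2 / 1) ^ i * t i ≡ t i + t i
  scale-t zero          = refl
  scale-t (suc zero)    = refl
  scale-t (suc (suc i)) = *-zeroʳ ((+ 2 / 1) ^ suc (suc i))
  -- G = B (2t) - B (t), with e²ᵗ B (2t) = B (2t) + 2t and e²ᵗ B (t) = B (t) + t + eᵗ t.
  translate²-genocchi : ∀ i → translate (translate genocchi) i ≡ genocchi i + t i - translate t i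
  translate²-genocchi i = begin
    translate (translate genocchi) i
      ≡⟨ translate-linear _ (translate bernoulli) (- 1ℚ) (translate-linear _ bernoulli (- 1ℚ) split) i ⟩
    translate (translate (scale bernoulli)) i + - 1ℚ * translate (translate bernoulli) i
      ≡⟨ cong₂ (λ x y → x + - 1ℚ * y) (translate²-scale bernoulli i) (translate-linear _ t 1ℚ translateB i) ⟩
    (+ 2 / 1) ^ i * translate bernoulli i + - 1ℚ * (translate bernoulli i + 1ℚ * translate t i)
      ≡⟨ cong (λ x → (+ 2 / 1) ^ i * x + - 1ℚ * (x + 1ℚ * translate t i)) (translate-bernoulli i) ⟩
    (+ 2 / 1) ^ i * (bernoulli i + t i) + - 1ℚ * (bernoulli i + t i + 1ℚ * translate t i)
      ≡⟨ lemma₁ ((+ 2 / 1) ^ i) (bernoulli i) (t i) (translate t i) ⟩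
    genocchi i + (((+ 2 / 1) ^ i * t i) - t i) - translate t i
      ≡⟨ cong (λ x → genocchi i + (x - t i) - translate t i) (scale-t i) ⟩
    genocchi i + (t i + t i - t i) - translate t i
      ≡⟨ lemma₂ (genocchi i) (t i) (translate t i) ⟩
    genocchi i + t i - translate t i ∎
    where
    lemma₁ : ∀ p b x y → p * (b + x) + - 1ℚ * (b + x + 1ℚ * y) ≡ (p - 1ℚ) * b + (p * x - x) - y
    lemma₁ = solve-∀ ring
    lemma₂ : ∀ a b c → a + (b + b - b) - c ≡ a + b - c
    lemma₂ = solve-∀ ring
  h-fixed : translate h ≗ h
  h-fixed i = begin
    translate h i
      ≡⟨ translate-linear (translate genocchi) (λ j → genocchi j + 1ℚ * t j) 1ℚ (λ _ → refl) i ⟩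
    translate (translate genocchi) i + 1ℚ * translate (λ j → genocchi j + 1ℚ * t j) i
      ≡⟨ cong₂ (λ x y → x + 1ℚ * y) (translate²-genocchi i)
               (translate-linear genocchi t 1ℚ (λ _ → refl) i) ⟩
    genocchi i + t i - translate t i + 1ℚ * (translate genocchi i + 1ℚ * translate t i)
      ≡⟨ lemma₁ (genocchi i) (t i) (translate t i) (translate genocchi i) ⟩
    h i ∎
    where
    lemma₁ : ∀ g x y z → g + x - y + 1ℚ * (z + 1ℚ * y) ≡ z + 1ℚ * (g + 1ℚ * x)
    lemma₁ = solve-∀ ring

-- Factorised polynomials and finite differences

-- Multiplication of a functional by Π_{|j| ≤ k} (x - j).
window : ℕ → Series → Series
window zero    a = mul 0ℚ a
window (suc k) a = mul (ι (suc k)) (mul (- ι (suc k)) (window k a))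

window-cong : ∀ k {a b} → a ≗ b → window k a ≗ window k b
window-cong zero    a≗b = mul-cong 0ℚ a≗b
window-cong (suc k) a≗b = mul-cong (ι (suc k)) (mul-cong (- ι (suc k)) (window-cong k a≗b))

window-linear : ∀ k u v c {w} → (∀ i → w i ≡ u i + c * v i) →
  ∀ i → window k w i ≡ window k u i + c * window k v i
window-linear zero    u v c w≗ = mul-linear 0ℚ u v c w≗
window-linear (suc k) u v c w≗ =
  mul-linear d (mul (- d) (window k u)) (mul (- d) (window k v)) c
    (mul-linear (- d) (window k u) (window k v) c (window-linear k u v c w≗))
  where d = ι (suc k)

window-mul : ∀ k c a → window k (mul c a) ≗ mul c (window k a)
window-mul zero    c a = mul-comm 0ℚ c a
window-mul (suc k) c a i = begin
  mul d (mul (- d) (window k (mul c a))) i   ≡⟨ mul-cong d (mul-cong (- d) (window-mul k c a)) i ⟩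
  mul d (mul (- d) (mul c (window k a))) i   ≡⟨ mul-cong d (mul-comm (- d) c (window k a)) i ⟩
  mul d (mul c (mul (- d) (window k a))) i   ≡⟨ mul-comm d c (mul (- d) (window k a)) i ⟩
  mul c (window (suc k) a) i                 ∎
  where
  open ≡-Reasoning
  d = ι (suc k)

-- The polynomial with roots -k-1, ..., k is the one with roots -k, ..., k+1 taken at x + 1.
translate-window : ∀ k a →
  translate (window k (mul (- ι (suc k)) a)) ≗ mul (ι (suc k)) (window k (translate a))
translate-window zero    a i = begin
  translate (mul 0ℚ (mul (- 1ℚ) a)) i   ≡⟨ translate-mul 0ℚ (mul (- 1ℚ) a) refl i ⟩
  mul 1ℚ (translate (mul (- 1ℚ) a)) i   ≡⟨ mul-cong 1ℚ (translate-mul (- 1ℚ) a refl) i ⟩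
  mul 1ℚ (mul 0ℚ (translate a)) i       ∎
  where open ≡-Reasoning
translate-window (suc k) a i = begin
  translate (mul d (mul (- d) (window k b))) i
    ≡⟨ translate-mul d (mul (- d) (window k b)) e≡ i ⟩
  mul e (translate (mul (- d) (window k b))) i
    ≡⟨ mul-cong e (translate-cong (window-mul k (- d) b)) i ⟨
  mul e (translate (window k (mul (- d) b))) i
    ≡⟨ mul-cong e (translate-window k b) i ⟩
  mul e (mul d (window k (translate b))) i
    ≡⟨ mul-cong e (mul-cong d (window-cong k (translate-mul (- e) a -d≡))) i ⟩
  mul e (mul d (window k (mul (- d) (translate a)))) i
    ≡⟨ mul-cong e (mul-cong d (window-mul k (- d) (translate a))) i ⟩
  mul e (window (suc k) (translate a)) i ∎
  where
  open ≡-Reasoning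
  d = ι (suc k)
  e = ι (suc (suc k))
  b = mul (- e) a
  e≡ : e ≡ d + 1ℚ
  e≡ = trans (ι-suc (suc k)) (+-comm 1ℚ d)
  lemma : ∀ d → - d ≡ - (1ℚ + d) + 1ℚ
  lemma = solve-∀ ring
  -d≡ : - d ≡ - e + 1ℚ
  -d≡ = trans (lemma d) (cong (λ x → - x + 1ℚ) (sym (ι-suc (suc k))))

sgn : ℕ → ℚ
sgn n = (- 1ℚ) ^ n

sgn-square : ∀ n → sgn n * sgn n ≡ 1ℚ
sgn-square zero    = refl
sgn-square (suc n) = trans (lemma (sgn n)) (sgn-square n)
  where
  lemma : ∀ x → - 1ℚ * x * (- 1ℚ * x) ≡ x * x
  lemma = solve-∀ ring

-- As functionals, `t` is p ↦ p′ (0) and `one` is p ↦ p (0). The product has a simple root at 0,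
-- with derivative Π (- j²) over 1 ≤ j ≤ k.
window-t : ∀ k i → window k t i ≡ sgn k * (fac k * fac k) * one i
window-t zero    zero          = refl
window-t zero    (suc zero)    = refl
window-t zero    (suc (suc i)) = refl
window-t (suc k) i
  rewrite window-t k (suc (suc i)) | window-t k (suc i) | window-t k i | fac-suc k | ι-suc k
  = lemma (ι k) (sgn k) (fac k) (one i)
  where
  lemma : ∀ k s f o → s * (f * f) * 0ℚ - - (1ℚ + k) * (s * (f * f) * 0ℚ)
    - (1ℚ + k) * (s * (f * f) * 0ℚ - - (1ℚ + k) * (s * (f * f) * o))
    ≡ - 1ℚ * s * ((1ℚ + k) * f * ((1ℚ + k) * f)) * o
  lemma = solve-∀ ring

-- With P = Π (x - j) over |j| ≤ k and d = k + 1, the polynomial of interest is x P = ½ ((x + d) P +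
-- (x - d) P), and (x + d) P is (x - d) P taken at x + 1. The result is - ½ times the derivative of
-- (x - d) P at 0.
window-genocchi : ∀ k → window k genocchi 1 ≡ ½ * (sgn k * fac k * fac (suc k))
window-genocchi k = begin
  w 1
    ≡⟨ lemma₁ d (w 1) (w 0) ⟩
  ½ * (w 1 - - d * w 0 + (w 1 - d * w 0))
    ≡⟨ cong (λ x → ½ * (x + (w 1 - d * w 0))) reflection ⟩
  ½ * (- 1ℚ * w 1 + - 1ℚ * (e * 0ℚ) - d * (- 1ℚ * w 0 + - 1ℚ * (e * 1ℚ)) + (w 1 - d * w 0))
    ≡⟨ cong (λ d → ½ * (- 1ℚ * w 1 + - 1ℚ * (e * 0ℚ) - d * (- 1ℚ * w 0 + - 1ℚ * (e * 1ℚ)) + (w 1 - d * w 0))) (ι-suc k) ⟩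
  ½ * (- 1ℚ * w 1 + - 1ℚ * (e * 0ℚ) - (1ℚ + ι k) * (- 1ℚ * w 0 + - 1ℚ * (e * 1ℚ)) + (w 1 - (1ℚ + ι k) * w 0))
    ≡⟨ lemma₂ (w 1) (w 0) (ι k) (sgn k) (fac k) ⟩
  ½ * (sgn k * fac k * ((1ℚ + ι k) * fac k))
    ≡⟨ cong (λ x → ½ * (sgn k * fac k * x)) (fac-suc k) ⟨
  ½ * (sgn k * fac k * fac (suc k)) ∎
  where
  open ≡-Reasoning
  w = window k genocchi
  d = ι (suc k)
  e = sgn k * (fac k * fac k)
  lemma₁ : ∀ d x y → x ≡ ½ * (x - - d * y + (x - d * y))
  lemma₁ = solve-∀ ring
  lemma₂ : ∀ x y k s f → ½ * (- 1ℚ * x + - 1ℚ * (s * (f * f) * 0ℚ) - (1ℚ + k) * (- 1ℚ * y + - 1ℚ * (s * (f * f) * 1ℚ)) + (x - (1ℚ + k) * y))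
    ≡ ½ * (s * f * ((1ℚ + k) * f))
  lemma₂ = solve-∀ ring
  split : ∀ i → translate genocchi i ≡ - 1ℚ * genocchi i + - 1ℚ * t i
  split i = trans (translate-genocchi i) (lemma (genocchi i) (t i))
    where
    lemma : ∀ x y → - x - y ≡ - 1ℚ * x + - 1ℚ * y
    lemma = solve-∀ ring
  scaled : ∀ i → window k (λ j → - 1ℚ * genocchi j) i ≡ - 1ℚ * w i
  -- `window-linear` takes the form u + c v, so - g is presented as g - 2 g.
  scaled i = trans (window-linear k genocchi genocchi (- (1ℚ + 1ℚ)) (λ j → lemma (genocchi j)) i) (lemma′ (w i))
    where
    lemma : ∀ x → - 1ℚ * x ≡ x + - (1ℚ + 1ℚ) * x
    lemma = solve-∀ ring
    lemma′ : ∀ x → x + - (1ℚ + 1ℚ) * x ≡ - 1ℚ * x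
    lemma′ = solve-∀ ring
  windowT : ∀ i → window k (translate genocchi) i ≡ - 1ℚ * w i + - 1ℚ * (e * one i)
  windowT i = trans (window-linear k (λ j → - 1ℚ * genocchi j) t (- 1ℚ) split i)
    (cong₂ (λ x y → x + - 1ℚ * y) (scaled i) (window-t k i))
  reflection : w 1 - - d * w 0 ≡ - 1ℚ * w 1 + - 1ℚ * (e * 0ℚ) - d * (- 1ℚ * w 0 + - 1ℚ * (e * 1ℚ))
  reflection = begin
    mul (- d) w 0                               ≡⟨ window-mul k (- d) genocchi 0 ⟨
    -- `translate` fixes the value at index 0, the constant polynomial 1, so it can be inserted
    -- here.
    translate (window k (mul (- d) genocchi)) 0 ≡⟨ translate-window k genocchi 0 ⟩
    mul d (window k (translate genocchi)) 0     ≡⟨ mul-cong d windowT 0 ⟩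
    - 1ℚ * w 1 + - 1ℚ * (e * 0ℚ) - d * (- 1ℚ * w 0 + - 1ℚ * (e * 1ℚ)) ∎

-- Multiplication of a functional by φₖ = Π_{j < k} (y - j²), where y = x² for evenGenocchi.
squares : ℕ → Series → Series
squares zero    a = a
squares (suc k) a = mul (ι k * ι k) (squares k a)

squares-linear : ∀ k u v c {w} → (∀ i → w i ≡ u i + c * v i) →
  ∀ i → squares k w i ≡ squares k u i + c * squares k v i
squares-linear zero    u v c w≗ = w≗
squares-linear (suc k) u v c w≗ =
  mul-linear (ι k * ι k) (squares k u) (squares k v) c (squares-linear k u v c w≗)

squares-mul : ∀ k c a → squares k (mul c a) ≗ mul c (squares k a)
squares-mul zero    c a i = refl
squares-mul (suc k) c a i =
  trans (mul-cong (ι k * ι k) (squares-mul k c a) i) (mul-comm (ι k * ι k) c (squares k a) i)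

evenGenocchi : Series
evenGenocchi k = genocchi (2 ℕ.* k)

-- φₖ₊₁ at x² is x² Π (x² - j²) over 1 ≤ j ≤ k, that is x times the product over |j| ≤ k; the spare
-- x makes the index odd.
squares-evenGenocchi : ∀ k i → squares (suc k) evenGenocchi i ≡ window k genocchi (suc (2 ℕ.* i))
squares-evenGenocchi zero    i =
  trans (cong (λ j → genocchi j - 0ℚ * genocchi (2 ℕ.* i)) (ℕ.*-suc 2 i))
        (lemma (genocchi (2 ℕ.+ 2 ℕ.* i)) (genocchi (2 ℕ.* i)) (genocchi (1 ℕ.+ 2 ℕ.* i)))
  where
  lemma : ∀ x y z → x - 0ℚ * y ≡ x - 0ℚ * z
  lemma = solve-∀ ring
squares-evenGenocchi (suc k) i
  rewrite squares-evenGenocchi k (suc i) | squares-evenGenocchi k i | ℕ.*-suc 2 i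
  = lemma (ι (suc k)) (w (3 ℕ.+ 2 ℕ.* i)) (w (2 ℕ.+ 2 ℕ.* i)) (w (1 ℕ.+ 2 ℕ.* i))
  where
  w = window k genocchi
  lemma : ∀ d x y z → x - d * d * z ≡ x - - d * y - d * (y - - d * z)
  lemma = solve-∀ ring

-- From φₘ₊₁ φₖ₊₁ = φₘ₊₂ φₖ + ((m + 1)² - k²) φₘ₊₁ φₖ, by induction on k.
squares² : ∀ m k → squares (suc m) (squares k evenGenocchi) 0
  ≡ ½ * (sgn (m ℕ.+ k) * fac (m ℕ.+ k) * fac k * fac (suc m))
squares² m zero    = begin
  squares (suc m) evenGenocchi 0
    ≡⟨ squares-evenGenocchi m 0 ⟩
  window m genocchi 1
    ≡⟨ window-genocchi m ⟩
  ½ * (sgn m * fac m * fac (suc m))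
    ≡⟨ cong (λ x → ½ * (x * fac (suc m))) (*-identityʳ (sgn m * fac m)) ⟨
  ½ * (sgn m * fac m * 1ℚ * fac (suc m))
    ≡⟨ cong (λ j → ½ * (sgn j * fac j * 1ℚ * fac (suc m))) (ℕ.+-identityʳ m) ⟨
  ½ * (sgn (m ℕ.+ 0) * fac (m ℕ.+ 0) * 1ℚ * fac (suc m)) ∎
  where open ≡-Reasoning
squares² m (suc k) = begin
  squares (suc m) (mul (ι k * ι k) a) 0
    ≡⟨ squares-mul (suc m) (ι k * ι k) a 0 ⟩
  squares (suc m) a 1 - ι k * ι k * squares (suc m) a 0
    ≡⟨ lemma₁ (ι (suc m)) (ι k) (squares (suc m) a 1) (squares (suc m) a 0) ⟩
  squares (suc (suc m)) a 0 + (ι (suc m) * ι (suc m) - ι k * ι k) * squares (suc m) a 0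
    ≡⟨ cong₂ (λ x y → x + (ι (suc m) * ι (suc m) - ι k * ι k) * y) (squares² (suc m) k) (squares² m k) ⟩
  ½ * (- 1ℚ * s * fac (suc (m ℕ.+ k)) * fac k * fac (suc (suc m)))
    + (ι (suc m) * ι (suc m) - ι k * ι k) * (½ * (s * F * fac k * fac (suc m)))
    ≡⟨ cong₂ (λ x y → ½ * (- 1ℚ * s * x * fac k * y)
         + (ι (suc m) * ι (suc m) - ι k * ι k) * (½ * (s * F * fac k * fac (suc m)))) F′ (fac-suc (suc m)) ⟩
  ½ * (- 1ℚ * s * ((1ℚ + (ι m + ι k)) * F) * fac k * ((1ℚ + ι (suc m)) * fac (suc m)))
    + (ι (suc m) * ι (suc m) - ι k * ι k) * (½ * (s * F * fac k * fac (suc m)))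
    ≡⟨ cong (λ x → ½ * (- 1ℚ * s * ((1ℚ + (ι m + ι k)) * F) * fac k * ((1ℚ + x) * fac (suc m)))
         + (x * x - ι k * ι k) * (½ * (s * F * fac k * fac (suc m)))) (ι-suc m) ⟩
  ½ * (- 1ℚ * s * ((1ℚ + (ι m + ι k)) * F) * fac k * ((1ℚ + (1ℚ + ι m)) * fac (suc m)))
    + ((1ℚ + ι m) * (1ℚ + ι m) - ι k * ι k) * (½ * (s * F * fac k * fac (suc m)))
    ≡⟨ lemma₂ (ι m) (ι k) s F (fac k) (fac (suc m)) ⟩
  ½ * (- 1ℚ * s * ((1ℚ + (ι m + ι k)) * F) * ((1ℚ + ι k) * fac k) * fac (suc m))
    ≡⟨ cong₂ (λ x y → ½ * (- 1ℚ * s * x * y * fac (suc m))) F′ (fac-suc k) ⟨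
  ½ * (sgn (suc (m ℕ.+ k)) * fac (suc (m ℕ.+ k)) * fac (suc k) * fac (suc m))
    ≡⟨ cong (λ j → ½ * (sgn j * fac j * fac (suc k) * fac (suc m))) (ℕ.+-suc m k) ⟨
  ½ * (sgn (m ℕ.+ suc k) * fac (m ℕ.+ suc k) * fac (suc k) * fac (suc m)) ∎
  where
  open ≡-Reasoning
  a = squares k evenGenocchi
  s = sgn (m ℕ.+ k)
  F = fac (m ℕ.+ k)
  F′ : fac (suc (m ℕ.+ k)) ≡ (1ℚ + (ι m + ι k)) * F
  F′ = trans (fac-suc (m ℕ.+ k)) (cong (λ x → (1ℚ + x) * F) (ι-+ m k))
  lemma₁ : ∀ m k x y → x - k * k * y ≡ x - m * m * y + (m * m - k * k) * y
  lemma₁ = solve-∀ ring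
  lemma₂ : ∀ m k s F f g →
    ½ * (- 1ℚ * s * ((1ℚ + (m + k)) * F) * f * ((1ℚ + (1ℚ + m)) * g))
      + ((1ℚ + m) * (1ℚ + m) - k * k) * (½ * (s * F * f * g))
    ≡ ½ * (- 1ℚ * s * ((1ℚ + (m + k)) * F) * ((1ℚ + k) * f) * g)
  lemma₂ = solve-∀ ring

-- Alternating binomial sums

-- alt s n = Σₖ (-1)ᵏ (n choose k) s k
alt : (ℕ → ℚ) → ℕ → ℚ
alt s zero    = s 0
alt s (suc n) = alt s n - alt (λ k → s (suc k)) n

alt-cong : ∀ {s s′} → s ≗ s′ → alt s ≗ alt s′
alt-cong s≗ zero    = s≗ 0
alt-cong s≗ (suc n) = cong₂ _-_ (alt-cong s≗ n) (alt-cong (λ k → s≗ (suc k)) n)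

alt-scale : ∀ c s n → alt (λ k → c * s k) n ≡ c * alt s n
alt-scale c s zero    = refl
alt-scale c s (suc n)
  rewrite alt-scale c s n | alt-scale c (λ k → s (suc k)) n = lemma c (alt s n) (alt (λ k → s (suc k)) n)
  where
  lemma : ∀ c x y → c * x - c * y ≡ c * (x - y)
  lemma = solve-∀ ring

alt-difference : ∀ s n → alt s (suc n) ≡ alt (λ k → s k - s (suc k)) n
alt-difference s zero    = refl
alt-difference s (suc n) = cong₂ _-_ (alt-difference s n) (alt-difference (λ k → s (suc k)) n)

alt-const : ∀ c n → alt (λ _ → c) (suc n) ≡ 0ℚ
alt-const c n = +-inverseʳ (alt (λ _ → c) n)

-- The product (N + 1) ⋯ (N + m), of degree m in N, in the factorial form in which it arises from
-- `squares²`.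
rising : ℕ → ℕ → ℚ
rising m N = fac (m ℕ.+ N) * 1/ N !

-- A discrete power rule: both products contain N + 2, ..., N + m + 1, and the remaining factors N +
-- 1 and N + m + 2 differ by m + 1.
rising-difference : ∀ m N → rising (suc m) N - rising (suc m) (suc N) ≡ - ι (suc m) * rising m (suc N)
rising-difference m N = begin
  fac (suc (m ℕ.+ N)) * 1/ N ! - fac (suc (m ℕ.+ suc N)) * 1/ suc N !
    ≡⟨ cong₂ (λ x y → fac x * 1/ N ! - y * 1/ suc N !) (sym (ℕ.+-suc m N)) (fac-suc (m ℕ.+ suc N)) ⟩
  F * 1/ N ! - (1ℚ + ι (m ℕ.+ suc N)) * F * 1/ suc N !
    ≡⟨ cong₂ (λ x y → F * x - (1ℚ + y) * F * 1/ suc N !)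
         (1/!-suc N) (trans (ι-+ m (suc N)) (cong (_+_ (ι m)) (ι-suc N))) ⟩
  F * ((1ℚ + ι N) * 1/ suc N !) - (1ℚ + (ι m + (1ℚ + ι N))) * F * 1/ suc N !
    ≡⟨ lemma F (ι N) (ι m) (1/ suc N !) ⟩
  - (1ℚ + ι m) * (F * 1/ suc N !)
    ≡⟨ cong (λ x → - x * (F * 1/ suc N !)) (ι-suc m) ⟨
  - ι (suc m) * rising m (suc N) ∎
  where
  open ≡-Reasoning
  F = fac (m ℕ.+ suc N)
  lemma : ∀ F n m i → F * ((1ℚ + n) * i) - (1ℚ + (m + (1ℚ + n))) * F * i ≡ - (1ℚ + m) * (F * i)
  lemma = solve-∀ ring

-- Taking one difference lowers the degree and the order together and advances the argument by one;
-- the offset r records this advance.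
alt-rising-suc : ∀ m n r →
  alt (λ k → rising (suc m) (k ℕ.+ r)) (suc n) ≡ - ι (suc m) * alt (λ k → rising m (k ℕ.+ suc r)) n
alt-rising-suc m n r = begin
  alt (λ k → rising (suc m) (k ℕ.+ r)) (suc n)
    ≡⟨ alt-difference (λ k → rising (suc m) (k ℕ.+ r)) n ⟩
  alt (λ k → rising (suc m) (k ℕ.+ r) - rising (suc m) (suc (k ℕ.+ r))) n
    ≡⟨ alt-cong (λ k → trans (rising-difference m (k ℕ.+ r))
         (cong (λ j → - ι (suc m) * rising m j) (sym (ℕ.+-suc k r)))) n ⟩
  alt (λ k → - ι (suc m) * rising m (k ℕ.+ suc r)) n
    ≡⟨ alt-scale (- ι (suc m)) (λ k → rising m (k ℕ.+ suc r)) n ⟩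
  - ι (suc m) * alt (λ k → rising m (k ℕ.+ suc r)) n ∎
  where open ≡-Reasoning

-- More differences than the degree annihilate a polynomial: after m of them it is constant.
alt-rising-< : ∀ {m n} → m ℕ.< n → ∀ r → alt (λ k → rising m (k ℕ.+ r)) n ≡ 0ℚ
alt-rising-< {zero}  {suc n} _     r = trans (alt-cong (λ k → n!*1/n! (k ℕ.+ r)) (suc n)) (alt-const 1ℚ n)
alt-rising-< {suc m} {suc n} 1+m<1+n r = trans (alt-rising-suc m n r)
  (trans (cong (- ι (suc m) *_) (alt-rising-< (ℕ.s<s⁻¹ 1+m<1+n) (suc r))) (*-zeroʳ (- ι (suc m))))

alt-rising-≡ : ∀ n r → alt (λ k → rising n (k ℕ.+ r)) n ≡ sgn n * fac n
alt-rising-≡ zero    r = n!*1/n! r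
alt-rising-≡ (suc n) r = begin
  alt (λ k → rising (suc n) (k ℕ.+ r)) (suc n)          ≡⟨ alt-rising-suc n n r ⟩
  - ι (suc n) * alt (λ k → rising n (k ℕ.+ suc r)) n    ≡⟨ cong (- ι (suc n) *_) (alt-rising-≡ n (suc r)) ⟩
  - ι (suc n) * (sgn n * fac n)                         ≡⟨ lemma (ι (suc n)) (sgn n) (fac n) ⟩
  - 1ℚ * sgn n * (ι (suc n) * fac n)                    ≡⟨ cong (- 1ℚ * sgn n *_) (ι-* (suc n) (n !)) ⟨
  sgn (suc n) * fac (suc n)                             ∎
  where
  open ≡-Reasoning
  lemma : ∀ x s f → - x * (s * f) ≡ - 1ℚ * s * (x * f)
  lemma = solve-∀ ring

1/1+n≡n!/1+n! : ∀ n → + 1 / suc n ≡ fac n * 1/ suc n !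
1/1+n≡n!/1+n! n = ι-cancelˡ n (begin
  ι (suc n) * (+ 1 / suc n)             ≡⟨ ι-inverseʳ n ⟩
  1ℚ                                    ≡⟨ n!*1/n! (suc n) ⟨
  fac (suc n) * 1/ suc n !              ≡⟨ cong (_* 1/ suc n !) (ι-* (suc n) (n !)) ⟩
  ι (suc n) * fac n * 1/ suc n !        ≡⟨ *-assoc (ι (suc n)) (fac n) (1/ suc n !) ⟩
  ι (suc n) * (fac n * 1/ suc n !)      ∎)
  where open ≡-Reasoning

-- Both sides are the Beta integral of xʳ (1 - x)ⁿ over [0, 1]. The induction splits off one factor
-- 1 - x, which raises r.
alt-reciprocal : ∀ n r → alt (λ k → + 1 / suc (k ℕ.+ r)) n ≡ fac n * fac r * 1/ suc (n ℕ.+ r) !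
alt-reciprocal zero    r = trans (1/1+n≡n!/1+n! r) (cong (_* 1/ suc r !) (sym (*-identityˡ (fac r))))
alt-reciprocal (suc n) r = begin
  alt (λ k → + 1 / suc (k ℕ.+ r)) n - alt (λ k → + 1 / suc (suc k ℕ.+ r)) n
    ≡⟨ cong₂ _-_ (alt-reciprocal n r)
        (trans (alt-cong (λ k → cong (λ j → + 1 / suc j) (sym (ℕ.+-suc k r))) n) (alt-reciprocal n (suc r))) ⟩
  fac n * fac r * 1/ suc (n ℕ.+ r) ! - fac n * fac (suc r) * 1/ suc (n ℕ.+ suc r) !
    ≡⟨ cong₂ (λ x y → fac n * fac r * x - fac n * fac (suc r) * 1/ suc y !)
         (trans (1/!-suc (suc (n ℕ.+ r))) (cong (λ x → (1ℚ + x) * I) (trans (ι-suc (n ℕ.+ r)) (cong (_+_ 1ℚ) (ι-+ n r)))))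
         (ℕ.+-suc n r) ⟩
  fac n * fac r * ((1ℚ + (1ℚ + (ι n + ι r))) * I) - fac n * fac (suc r) * I
    ≡⟨ cong (λ x → fac n * fac r * ((1ℚ + (1ℚ + (ι n + ι r))) * I) - fac n * x * I) (fac-suc r) ⟩
  fac n * fac r * ((1ℚ + (1ℚ + (ι n + ι r))) * I) - fac n * ((1ℚ + ι r) * fac r) * I
    ≡⟨ lemma (fac n) (fac r) (ι n) (ι r) I ⟩
  (1ℚ + ι n) * fac n * fac r * I
    ≡⟨ cong (λ x → x * fac r * I) (fac-suc n) ⟨
  fac (suc n) * fac r * I ∎
  where
  open ≡-Reasoning
  I = 1/ suc (suc (n ℕ.+ r)) !
  lemma : ∀ f g n r i → f * g * ((1ℚ + (1ℚ + (n + r))) * i) - f * ((1ℚ + r) * g) * i ≡ (1ℚ + n) * f * g * i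
  lemma = solve-∀ ring

harmonic-suc : ∀ n → harmonic (suc n) ≡ harmonic n + (+ 1 / suc n)
harmonic-suc n = trans (sum-init-last {n} (λ i → + 1 / suc (toℕ i)))
  (cong₂ _+_ (sum-cong-≗ {n} (λ i → cong (λ j → + 1 / suc j) (toℕ-inject₁ i)))
             (cong (λ j → + 1 / suc j) (toℕ-fromℕ n)))

-- The increment in n is minus the alternating sum of the shifted sequence, and for the reciprocals
-- 1 / (k + 1) that sum is 1 / (n + 1).
alt-harmonic : ∀ s → s 0 ≡ 0ℚ → (∀ k → s (suc k) ≡ - ½ * (+ 1 / suc k)) →
  ∀ n → alt s n ≡ ½ * harmonic n
alt-harmonic s s₀ s₊ zero    = trans s₀ refl
alt-harmonic s s₀ s₊ (suc n) = begin
  alt s n - alt (λ k → s (suc k)) n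
    ≡⟨ cong₂ _-_ (alt-harmonic s s₀ s₊ n) (trans (alt-cong shifted n)
         (trans (alt-scale (- ½) (λ k → + 1 / suc (k ℕ.+ 0)) n) (cong (- ½ *_) reciprocal))) ⟩
  ½ * harmonic n - - ½ * (+ 1 / suc n)
    ≡⟨ lemma (harmonic n) (+ 1 / suc n) ⟩
  ½ * (harmonic n + (+ 1 / suc n))
    ≡⟨ cong (½ *_) (harmonic-suc n) ⟨
  ½ * harmonic (suc n) ∎
  where
  open ≡-Reasoning
  shifted : ∀ k → s (suc k) ≡ - ½ * (+ 1 / suc (k ℕ.+ 0))
  shifted k = trans (s₊ k) (cong (λ j → - ½ * (+ 1 / suc j)) (sym (ℕ.+-identityʳ k)))
  reciprocal : alt (λ k → + 1 / suc (k ℕ.+ 0)) n ≡ + 1 / suc n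
  reciprocal = begin
    alt (λ k → + 1 / suc (k ℕ.+ 0)) n      ≡⟨ alt-reciprocal n 0 ⟩
    fac n * 1ℚ * 1/ suc (n ℕ.+ 0) !        ≡⟨ cong₂ (λ x j → x * 1/ suc j !) (*-identityʳ (fac n)) (ℕ.+-identityʳ n) ⟩
    fac n * 1/ suc n !                     ≡⟨ 1/1+n≡n!/1+n! n ⟨
    + 1 / suc n                            ∎
  lemma : ∀ x y → ½ * x - - ½ * y ≡ ½ * (x + y)
  lemma = solve-∀ ring

-- Column operations on Hankel determinants

column : Series → ℕ → Series
column a j i = a (i ℕ.+ j)

columns : Series → ℕ → List Series
columns a = applyUpTo (column a)

-- The combinations of the first n columns of the Hankel matrix of a.
data Span (a : Series) (n : ℕ) (w : Series) : Set where
  null        : (∀ i → w i ≡ 0ℚ) → Span a n w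
  generator   : ∀ j → j ℕ.< n → w ≗ column a j → Span a n w
  combination : ∀ c {u v} → Span a n u → Span a n v → (∀ i → w i ≡ u i + c * v i) → Span a n w

-- As a functional, w is a multiplied by a polynomial of degree at most n whose coefficient in
-- degree n is x.
Leading : Series → ℕ → ℚ → Series → Set
Leading a n x w = ∃ λ u → Span a n u × (∀ i → w i ≡ u i + x * column a n i)

span-suc : ∀ {a n w} → Span a n w → Span a (suc n) w
span-suc (null w≗0)              = null w≗0
span-suc (generator j j<n w≗)    = generator j (ℕ.m<n⇒m<1+n j<n) w≗
span-suc (combination c u v w≗)  = combination c (span-suc u) (span-suc v) w≗

span-shift : ∀ {a n w} → Span a n w → Span a (suc n) (shift w)
span-shift (null w≗0)                 = null (λ i → w≗0 (suc i))
span-shift {a} (generator j j<n w≗)   = generator (suc j) (ℕ.s<s j<n)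
  (λ i → trans (w≗ (suc i)) (cong a (sym (ℕ.+-suc i j))))
span-shift (combination c u v w≗)     = combination c (span-shift u) (span-shift v) (λ i → w≗ (suc i))

leading⇒span : ∀ {a n w} x → Leading a n x w → Span a (suc n) w
leading⇒span x (u , u∈ , w≗) =
  combination x (span-suc u∈) (generator _ ℕ.≤-refl (λ _ → refl)) w≗

leading-scale : ∀ {a n x w} c → Leading a n x w → Leading a n (c * x) (λ i → c * w i)
leading-scale {a} {n} {x} c (u , u∈ , w≗) =
  (λ i → 0ℚ + c * u i) ,
  combination c {u = λ _ → 0ℚ} (null (λ _ → refl)) u∈ (λ _ → refl) ,
  (λ i → trans (cong (c *_) (w≗ i)) (lemma c (u i) x (column a n i)))
  where
  lemma : ∀ c u x y → c * (u + x * y) ≡ 0ℚ + c * u + c * x * y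
  lemma = solve-∀ ring

leading-mul : ∀ {a n w} d → Leading a n 1ℚ w → Leading a (suc n) 1ℚ (mul d w)
leading-mul {a} {n} {w} d lw@(u , u∈ , w≗) =
  (λ i → u (suc i) + - d * w i) ,
  combination (- d) (span-shift u∈) (leading⇒span 1ℚ lw) (λ _ → refl) ,
  (λ i → trans (cong (_- d * w i) (trans (w≗ (suc i)) (cong (λ j → u (suc i) + 1ℚ * a j) (sym (ℕ.+-suc i n)))))
               (lemma (u (suc i)) (column a (suc n) i) d (w i)))
  where
  lemma : ∀ x y d w → x + 1ℚ * y - d * w ≡ x + - d * w + 1ℚ * y
  lemma = solve-∀ ring

leading-squares : ∀ a k → Leading a k 1ℚ (squares k a)
leading-squares a zero    = (λ _ → 0ℚ) , null (λ _ → refl) ,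
  (λ i → trans (cong a (sym (ℕ.+-identityʳ i))) (lemma (a (i ℕ.+ 0))))
  where
  lemma : ∀ x → x ≡ 0ℚ + 1ℚ * x
  lemma = solve-∀ ring
leading-squares a (suc k) = leading-mul (ι k * ι k) (leading-squares a k)

-- Only the term k = n reaches the top degree. The recursion of `alt` passes to k ↦ s (k + 1), whose
-- degrees start one higher; d keeps track of this.
leading-alt : ∀ {a} (s : ℕ → Series) (x : ℕ → ℚ) d → (∀ k → Leading a (k ℕ.+ d) (x k) (s k)) →
  ∀ n → Leading a (n ℕ.+ d) (sgn n * x n) (λ i → alt (λ k → s k i) n)
leading-alt {a} s x d ls zero    with ls 0
... | u , u∈ , w≗ = u , u∈ , (λ i → trans (w≗ i) (cong (λ y → u i + y * column a d i) (sym (*-identityˡ (x 0)))))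
leading-alt {a} s x d ls (suc n)
  with subst (λ j → Leading a j (sgn n * x (suc n)) (λ i → alt (λ k → s (suc k) i) n)) (ℕ.+-suc n d)
         (leading-alt (λ k → s (suc k)) (λ k → x (suc k)) (suc d)
           (λ k → subst (λ j → Leading a j (x (suc k)) (s (suc k))) (sym (ℕ.+-suc k d)) (ls (suc k))) n)
... | u , u∈ , w≗ =
  (λ i → alt (λ k → s k i) n + - 1ℚ * u i) ,
  combination (- 1ℚ) (leading⇒span (sgn n * x n) (leading-alt s x d ls n)) u∈ (λ _ → refl) ,
  (λ i → trans (cong (_-_ (alt (λ k → s k i) n)) (w≗ i))
               (lemma (alt (λ k → s k i) n) (u i) (sgn n) (x (suc n)) (column a (suc n ℕ.+ d) i)))
  where
  lemma : ∀ p u s x y → p - (u + s * x * y) ≡ p + - 1ℚ * u + - 1ℚ * s * x * y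
  lemma = solve-∀ ring

applyUpTo-split : ∀ (f : ℕ → Series) {j n} → j ℕ.< n →
  ∃₂ λ pre post → applyUpTo f n ≡ pre ++ f j ∷ post
applyUpTo-split f {zero}  {suc n} j<n = [] , applyUpTo (f ∘ suc) n , refl
applyUpTo-split f {suc j} {suc n} j<n with applyUpTo-split (f ∘ suc) (ℕ.s<s⁻¹ j<n)
... | pre , post , eq = f 0 ∷ pre , post , cong (f 0 ∷_) eq

detᶜ-span : ∀ N r {a n w} → Span a n w → detᶜ N r (columns a n ∷ʳ w) ≡ 0ℚ
detᶜ-span N r {a} {n} {w} (null w≗0) = begin
  detᶜ N r (columns a n ∷ʳ w)
    -- A zero column satisfies w = w + (-1) w, so linearity gives x - x.
    ≡⟨ detᶜ-linear N r (columns a n) {w} {w} {w} { - 1ℚ} (λ i → trans (w≗0 i) (cong (λ x → x + - 1ℚ * x) (sym (w≗0 i)))) ⟩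
  x + - 1ℚ * x
    ≡⟨ lemma x ⟩
  0ℚ ∎
  where
  open ≡-Reasoning
  x = detᶜ N r (columns a n ∷ʳ w)
  lemma : ∀ x → x + - 1ℚ * x ≡ 0ℚ
  lemma = solve-∀ ring
detᶜ-span N r {a} {n} {w} (generator j j<n w≗) with applyUpTo-split (column a) j<n
... | pre , post , eq = begin
  detᶜ N r (columns a n ∷ʳ w)
    -- The coefficient 0 only serves to replace w by the pointwise equal column c.
    ≡⟨ detᶜ-linear N r (columns a n) {c} {c} {w} {0ℚ} (λ i → trans (w≗ i) (lemma (c i))) ⟩
  detᶜ N r (columns a n ∷ʳ c) + 0ℚ * detᶜ N r (columns a n ∷ʳ c)
    ≡⟨ lemma (detᶜ N r (columns a n ∷ʳ c)) ⟨
  detᶜ N r (columns a n ∷ʳ c)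
    ≡⟨ cong (λ l → detᶜ N r (l ∷ʳ c)) eq ⟩
  detᶜ N r ((pre ++ c ∷ post) ∷ʳ c)
    ≡⟨ cong (detᶜ N r) (++-assoc pre (c ∷ post) [ c ]) ⟩
  detᶜ N r (pre ++ c ∷ post ++ [ c ])
    ≡⟨ alternating-duplicate (detᶜ N r) (detᶜ-alternating N r) pre c post [] ⟩
  0ℚ ∎
  where
  open ≡-Reasoning
  c = column a j
  lemma : ∀ x → x ≡ x + 0ℚ * x
  lemma = solve-∀ ring
detᶜ-span N r {a} {n} {w} (combination c {u} {v} u∈ v∈ w≗) = begin
  detᶜ N r (columns a n ∷ʳ w)
    ≡⟨ detᶜ-linear N r (columns a n) {u} {v} {w} {c} w≗ ⟩
  detᶜ N r (columns a n ∷ʳ u) + c * detᶜ N r (columns a n ∷ʳ v)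
    ≡⟨ cong₂ (λ x y → x + c * y) (detᶜ-span N r u∈) (detᶜ-span N r v∈) ⟩
  0ℚ + c * 0ℚ
    ≡⟨ lemma c ⟩
  0ℚ ∎
  where
  open ≡-Reasoning
  lemma : ∀ c → 0ℚ + c * 0ℚ ≡ 0ℚ
  lemma = solve-∀ ring

-- The difference of w and the last column lies in the span of the other columns. As r is arbitrary,
-- one w serves both Hankel matrices.
detᶜ-monic : ∀ N r {a n w} → Leading a n 1ℚ w →
  detᶜ N r (columns a (suc n)) ≡ detᶜ N r (columns a n ∷ʳ w)
detᶜ-monic N r {a} {n} {w} (u , u∈ , w≗) = begin
  detᶜ N r (columns a (suc n))
    ≡⟨ cong (detᶜ N r) (applyUpTo-∷ʳ (column a) n) ⟨
  detᶜ N r (columns a n ∷ʳ column a n)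
    ≡⟨ lemma (detᶜ N r (columns a n ∷ʳ column a n)) ⟩
  0ℚ + 1ℚ * detᶜ N r (columns a n ∷ʳ column a n)
    ≡⟨ cong (_+ 1ℚ * detᶜ N r (columns a n ∷ʳ column a n)) (detᶜ-span N r u∈) ⟨
  detᶜ N r (columns a n ∷ʳ u) + 1ℚ * detᶜ N r (columns a n ∷ʳ column a n)
    ≡⟨ detᶜ-linear N r (columns a n) {u} {column a n} {w} {1ℚ} w≗ ⟨
  detᶜ N r (columns a n ∷ʳ w) ∎
  where
  open ≡-Reasoning
  lemma : ∀ x → x ≡ 0ℚ + 1ℚ * x
  lemma = solve-∀ ring

tabulate-columns : ∀ (f : ℕ → Series) n → tabulate {n = n} (λ j → f (toℕ j)) ≡ applyUpTo f n
tabulate-columns f zero    = refl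
tabulate-columns f (suc n) = cong (f 0 ∷_) (tabulate-columns (f ∘ suc) n)

det-hankel : ∀ N r a → det {N} (λ i j → a (r ℕ.+ toℕ i ℕ.+ toℕ j)) ≡ detᶜ N r (columns a N)
det-hankel N r a = trans (det≡detᶜ N r (λ j → column a (toℕ j)))
                         (cong (detᶜ N r) (tabulate-columns (column a) N))

-- Orthogonality of pₙ and its two remaining values

-- φₖ₊₁ is monic of degree k + 1 without constant term, so only its top term survives. The value w 0
-- stays unconstrained; for pₙ it carries 𝓗ₙ.
squares-suc : ∀ w k i → VanishesOn w 1 (i ℕ.+ k) → squares (suc k) w i ≡ w (suc (i ℕ.+ k))
squares-suc w zero    i w≗0 = trans (lemma (w (suc i)) (w i)) (cong (w ∘ suc) (sym (ℕ.+-identityʳ i)))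
  where
  lemma : ∀ x y → x - 0ℚ * y ≡ x
  lemma = solve-∀ ring
squares-suc w (suc k) i w≗0 = begin
  squares (suc k) w (suc i) - d * squares (suc k) w i
    ≡⟨ cong₂ (λ x y → x - d * y)
         (squares-suc w k (suc i) (λ j j< → w≗0 j (subst (λ l → j ℕ.< l) (sym (ℕ.+-suc i k)) j<)))
         (squares-suc w k i (λ j j< → w≗0 j (ℕ.<-trans j< i+k<i+1+k))) ⟩
  w (suc (suc i ℕ.+ k)) - d * w (suc (i ℕ.+ k))
    ≡⟨ cong₂ (λ j y → w (suc j) - d * y) (sym (ℕ.+-suc i k)) (w≗0 (i ℕ.+ k) i+k<i+1+k) ⟩
  w (suc (i ℕ.+ suc k)) - d * 0ℚ
    ≡⟨ lemma (w (suc (i ℕ.+ suc k))) d ⟩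
  w (suc (i ℕ.+ suc k)) ∎
  where
  open ≡-Reasoning
  d = ι (suc k) * ι (suc k)
  i+k<i+1+k : i ℕ.+ k ℕ.< i ℕ.+ suc k
  i+k<i+1+k = ℕ.+-monoʳ-< i ℕ.≤-refl
  lemma : ∀ x d → x - d * 0ℚ ≡ x
  lemma = solve-∀ ring

-- φ₁, ..., φₙ are triangular with respect to y, ..., yⁿ, so vanishing on the former passes to the
-- latter.
vanishes : ∀ w n → (∀ m → m ℕ.< n → squares (suc m) w 0 ≡ 0ℚ) → VanishesOn w 1 n
vanishes w (suc n) ⊥w i i<1+n with ℕ.m<1+n⇒m<n∨m≡n i<1+n
... | inj₁ i<n  = vanishes w n (λ m m<n → ⊥w m (ℕ.m<n⇒m<1+n m<n)) i i<n
... | inj₂ refl = trans (sym (squares-suc w n 0 (vanishes w n (λ m m<n → ⊥w m (ℕ.m<n⇒m<1+n m<n)))))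
                        (⊥w n ℕ.≤-refl)

squares-scale : ∀ m c w i → squares m (λ j → c * w j) i ≡ c * squares m w i
squares-scale m c w i = trans (squares-linear m w w (c - 1ℚ) (λ j → lemma c (w j)) i) (sym (lemma c (squares m w i)))
  where
  lemma : ∀ c x → c * x ≡ x + (c - 1ℚ) * x
  lemma = solve-∀ ring

squares-alt : ∀ m (s : ℕ → Series) n i →
  squares m (λ j → alt (λ k → s k j) n) i ≡ alt (λ k → squares m (s k) i) n
squares-alt m s zero    i = refl
squares-alt m s (suc n) i = begin
  squares m (λ j → alt (λ k → s k j) (suc n)) i
    ≡⟨ squares-linear m u v (- 1ℚ) (λ j → lemma (u j) (v j)) i ⟩
  squares m u i + - 1ℚ * squares m v i
    ≡⟨ lemma (squares m u i) (squares m v i) ⟨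
  squares m u i - squares m v i
    ≡⟨ cong₂ _-_ (squares-alt m s n i) (squares-alt m (λ k → s (suc k)) n i) ⟩
  alt (λ k → squares m (s k) i) (suc n) ∎
  where
  open ≡-Reasoning
  u v : Series
  u j = alt (λ k → s k j) n
  v j = alt (λ k → s (suc k) j) n
  lemma : ∀ x y → x - y ≡ x + - 1ℚ * y
  lemma = solve-∀ ring

-- (-1)ᵏ cancels the sign in alt, so that orthogonal n is pₙ acting on evenGenocchi.
weight : ℕ → ℚ
weight k = sgn k * (1/ k ! * 1/ k !)

orthogonal : ℕ → Series
orthogonal n i = fac n * fac n * alt (λ k → weight k * squares k evenGenocchi i) n

orthogonal-monic : ∀ n → Leading evenGenocchi n 1ℚ (orthogonal n)
orthogonal-monic n = subst (λ x → Leading evenGenocchi n x (orthogonal n)) one≡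
  (leading-scale (fac n * fac n)
    (subst (λ j → Leading evenGenocchi j (sgn n * (weight n * 1ℚ))
             (λ i → alt (λ k → weight k * squares k evenGenocchi i) n)) (ℕ.+-identityʳ n)
      (leading-alt (λ k i → weight k * squares k evenGenocchi i) (λ k → weight k * 1ℚ) 0
        (λ k → subst (λ j → Leading evenGenocchi j (weight k * 1ℚ) (λ i → weight k * squares k evenGenocchi i))
                 (sym (ℕ.+-identityʳ k)) (leading-scale (weight k) (leading-squares evenGenocchi k))) n)))
  where
  open ≡-Reasoning
  lemma : ∀ f s i → f * f * (s * (s * (i * i) * 1ℚ)) ≡ s * s * (f * i * (f * i))
  lemma = solve-∀ ring
  one≡ : fac n * fac n * (sgn n * (weight n * 1ℚ)) ≡ 1ℚ
  one≡ = trans (lemma (fac n) (sgn n) (1/ n !))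
    (cong₂ (λ x y → x * (y * y)) (sgn-square n) (n!*1/n! n))

-- Against `weight k`, the sign (-1)ᵏ and the factor k! of `squares²` cancel, leaving (m + k)! / k!.
-- The k + 0 is the offset r = 0 of the `alt-rising` lemmas.
squares-orthogonal : ∀ m n → squares (suc m) (orthogonal n) 0 ≡
  fac n * fac n * (½ * (sgn m * fac (suc m)) * alt (λ k → rising m (k ℕ.+ 0)) n)
squares-orthogonal m n = begin
  squares (suc m) (orthogonal n) 0
    ≡⟨ squares-scale (suc m) (fac n * fac n) (λ i → alt (λ k → weight k * squares k evenGenocchi i) n) 0 ⟩
  fac n * fac n * squares (suc m) (λ i → alt (λ k → weight k * squares k evenGenocchi i) n) 0
    ≡⟨ cong (fac n * fac n *_) (squares-alt (suc m) (λ k i → weight k * squares k evenGenocchi i) n 0) ⟩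
  fac n * fac n * alt (λ k → squares (suc m) (λ i → weight k * squares k evenGenocchi i) 0) n
    ≡⟨ cong (fac n * fac n *_) (alt-cong term n) ⟩
  fac n * fac n * alt (λ k → ½ * (sgn m * fac (suc m)) * rising m (k ℕ.+ 0)) n
    ≡⟨ cong (fac n * fac n *_) (alt-scale (½ * (sgn m * fac (suc m))) (λ k → rising m (k ℕ.+ 0)) n) ⟩
  fac n * fac n * (½ * (sgn m * fac (suc m)) * alt (λ k → rising m (k ℕ.+ 0)) n) ∎
  where
  open ≡-Reasoning
  lemma : ∀ s i s′ F f g → s * (i * i) * (½ * (s′ * s * F * f * g)) ≡ s * s * (f * i) * (½ * (s′ * g) * (F * i))
  lemma = solve-∀ ring
  term : ∀ k → squares (suc m) (λ i → weight k * squares k evenGenocchi i) 0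
             ≡ ½ * (sgn m * fac (suc m)) * rising m (k ℕ.+ 0)
  term k = begin
    squares (suc m) (λ i → weight k * squares k evenGenocchi i) 0
      ≡⟨ squares-scale (suc m) (weight k) (squares k evenGenocchi) 0 ⟩
    weight k * squares (suc m) (squares k evenGenocchi) 0
      ≡⟨ cong (weight k *_) (squares² m k) ⟩
    weight k * (½ * (sgn (m ℕ.+ k) * fac (m ℕ.+ k) * fac k * fac (suc m)))
      ≡⟨ cong (λ s → weight k * (½ * (s * fac (m ℕ.+ k) * fac k * fac (suc m)))) (^-homo-* (- 1ℚ) m k) ⟩
    weight k * (½ * (sgn m * sgn k * fac (m ℕ.+ k) * fac k * fac (suc m)))
      ≡⟨ lemma (sgn k) (1/ k !) (sgn m) (fac (m ℕ.+ k)) (fac k) (fac (suc m)) ⟩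
    sgn k * sgn k * (fac k * 1/ k !) * (½ * (sgn m * fac (suc m)) * rising m k)
      ≡⟨ cong₂ (λ x y → x * y * (½ * (sgn m * fac (suc m)) * rising m k)) (sgn-square k) (n!*1/n! k) ⟩
    1ℚ * (½ * (sgn m * fac (suc m)) * rising m k)
      ≡⟨ *-identityˡ _ ⟩
    ½ * (sgn m * fac (suc m)) * rising m k
      ≡⟨ cong (λ j → ½ * (sgn m * fac (suc m)) * rising m j) (ℕ.+-identityʳ k) ⟨
    ½ * (sgn m * fac (suc m)) * rising m (k ℕ.+ 0) ∎

orthogonal-vanishes : ∀ n → VanishesOn (orthogonal n) 1 n
orthogonal-vanishes n = vanishes (orthogonal n) n λ m m<n →
  trans (squares-orthogonal m n)
    (trans (cong (λ x → fac n * fac n * (½ * (sgn m * fac (suc m)) * x)) (alt-rising-< m<n 0))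
           (lemma (fac n * fac n) (½ * (sgn m * fac (suc m)))))
  where
  lemma : ∀ x y → x * (y * 0ℚ) ≡ 0ℚ
  lemma = solve-∀ ring

-- Since the powers y, ..., yⁿ give 0, yⁿ⁺¹ may be replaced by φₙ₊₁, and the n-th difference then
-- meets a polynomial of degree exactly n.
orthogonal-norm : ∀ n → orthogonal n (suc n) ≡
  fac n * fac n * (½ * (sgn n * fac (suc n)) * (sgn n * fac n))
orthogonal-norm n = begin
  orthogonal n (suc n)
    ≡⟨ squares-suc (orthogonal n) n 0 (orthogonal-vanishes n) ⟨
  squares (suc n) (orthogonal n) 0
    ≡⟨ squares-orthogonal n n ⟩
  fac n * fac n * (½ * (sgn n * fac (suc n)) * alt (λ k → rising n (k ℕ.+ 0)) n)
    ≡⟨ cong (λ x → fac n * fac n * (½ * (sgn n * fac (suc n)) * x)) (alt-rising-≡ n 0) ⟩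
  fac n * fac n * (½ * (sgn n * fac (suc n)) * (sgn n * fac n)) ∎
  where open ≡-Reasoning

-- φ₀ contributes 2⁰ - 1 = 0, and the weighted value on φₖ₊₁ collapses to - ½ k! / (k + 1)!.
orthogonal-zero : ∀ n → orthogonal n 0 ≡ fac n * fac n * (½ * harmonic n)
orthogonal-zero n = cong (fac n * fac n *_)
  (alt-harmonic (λ k → weight k * squares k evenGenocchi 0) refl term n)
  where
  open ≡-Reasoning
  lemma : ∀ s i g f → - 1ℚ * s * (i * i) * (½ * (s * f * g)) ≡ s * s * (g * i) * (- ½ * (f * i))
  lemma = solve-∀ ring
  term : ∀ k → weight (suc k) * squares (suc k) evenGenocchi 0 ≡ - ½ * (+ 1 / suc k)
  term k = begin
    weight (suc k) * squares (suc k) evenGenocchi 0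
      ≡⟨ cong (weight (suc k) *_) (trans (squares-evenGenocchi k 0) (window-genocchi k)) ⟩
    weight (suc k) * (½ * (sgn k * fac k * fac (suc k)))
      ≡⟨ lemma (sgn k) (1/ suc k !) (fac (suc k)) (fac k) ⟩
    sgn k * sgn k * (fac (suc k) * 1/ suc k !) * (- ½ * (fac k * 1/ suc k !))
      ≡⟨ cong₂ (λ x y → x * y * (- ½ * (fac k * 1/ suc k !))) (sgn-square k) (n!*1/n! (suc k)) ⟩
    1ℚ * (- ½ * (fac k * 1/ suc k !))
      ≡⟨ *-identityˡ _ ⟩
    - ½ * (fac k * 1/ suc k !)
      ≡⟨ cong (- ½ *_) (1/1+n≡n!/1+n! k) ⟨
    - ½ * (+ 1 / suc k) ∎

proposition3p4 : ∀ (n : ℕ) → 1 ≤ n →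
    hankel n (λ k → ((+ 2 / 1) ^ (2 ℕ.* k) - 1ℚ) * bernoulli (2 ℕ.* k))
    ≡ (- 1ℚ) ^ n * (1/ n ! * 1/ suc n !) * harmonic n
    * hankel n (λ k → ((+ 2 / 1) ^ (2 ℕ.* k ℕ.+ 2) - 1ℚ) * bernoulli (2 ℕ.* k ℕ.+ 2))
proposition3p4 n _ = begin
  hankel n evenGenocchi
    ≡⟨ det-hankel (suc n) 0 evenGenocchi ⟩
  detᶜ (suc n) 0 (columns evenGenocchi (suc n))
    ≡⟨ detᶜ-monic (suc n) 0 (orthogonal-monic n) ⟩
  detᶜ (suc n) 0 (cols ∷ʳ orthogonal n)
    -- From row 0, the entry left in the last column is the top one; its sign is the (-1)ⁿ of the
    -- theorem.
    ≡⟨ detᶜ-last-top n 0 {orthogonal n} (orthogonal-vanishes n) cols ⟩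
  sgn (length cols) * orthogonal n 0 * D
    ≡⟨ cong₂ (λ k x → sgn k * x * D) (length-applyUpTo (column evenGenocchi) n) (orthogonal-zero n) ⟩
  sgn n * (fac n * fac n * (½ * harmonic n)) * D
    -- The products n! · 1/n! and (n + 1)! · 1/(n + 1)! and a squared sign are inserted as 1, so
    -- that the regrouping is a pure ring identity.
    ≡⟨ *-identityˡ _ ⟨
  1ℚ * (sgn n * (fac n * fac n * (½ * harmonic n)) * D)
    ≡⟨ cong (_* (sgn n * (fac n * fac n * (½ * harmonic n)) * D)) units ⟨
  (sgn n * sgn n) * (fac n * 1/ n !) * (fac (suc n) * 1/ suc n !) * (sgn n * (fac n * fac n * (½ * harmonic n)) * D)
    ≡⟨ lemma (sgn n) (fac n) (fac (suc n)) (1/ n !) (1/ suc n !) (harmonic n) D ⟩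
  sgn n * (1/ n ! * 1/ suc n !) * harmonic n * (fac n * fac n * (½ * (sgn n * fac (suc n)) * (sgn n * fac n)) * D)
    ≡⟨ cong (λ x → sgn n * (1/ n ! * 1/ suc n !) * harmonic n * (x * D)) (orthogonal-norm n) ⟨
  sgn n * (1/ n ! * 1/ suc n !) * harmonic n * (orthogonal n (suc n) * D)
    ≡⟨ cong (sgn n * (1/ n ! * 1/ suc n !) * harmonic n *_) shifted ⟨
  sgn n * (1/ n ! * 1/ suc n !) * harmonic n * hankel n (λ k → genocchi (2 ℕ.* k ℕ.+ 2)) ∎
  where
  open ≡-Reasoning
  cols = columns evenGenocchi n
  D = detᶜ n 1 cols
  units : (sgn n * sgn n) * (fac n * 1/ n !) * (fac (suc n) * 1/ suc n !) ≡ 1ℚ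
  units = trans (cong₂ (λ x y → x * y * (fac (suc n) * 1/ suc n !)) (sgn-square n) (n!*1/n! n))
                (trans (*-identityˡ _) (n!*1/n! (suc n)))
  lemma : ∀ s f g i j h d → (s * s) * (f * i) * (g * j) * (s * (f * f * (½ * h)) * d)
    ≡ s * (i * j) * h * (f * f * (½ * (s * g) * (s * f)) * d)
  lemma = solve-∀ ring
  shifted : hankel n (λ k → genocchi (2 ℕ.* k ℕ.+ 2)) ≡ orthogonal n (suc n) * D
  shifted = begin
    hankel n (λ k → genocchi (2 ℕ.* k ℕ.+ 2))
      ≡⟨ det-cong {suc n} (λ i j → cong genocchi (trans (ℕ.+-comm (2 ℕ.* (toℕ i ℕ.+ toℕ j)) 2)
                                                (sym (ℕ.*-suc 2 (toℕ i ℕ.+ toℕ j))))) ⟩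
    det {suc n} (λ i j → evenGenocchi (1 ℕ.+ toℕ i ℕ.+ toℕ j))
      ≡⟨ det-hankel (suc n) 1 evenGenocchi ⟩
    detᶜ (suc n) 1 (columns evenGenocchi (suc n))
      ≡⟨ detᶜ-monic (suc n) 1 (orthogonal-monic n) ⟩
    detᶜ (suc n) 1 (cols ∷ʳ orthogonal n)
      -- From row 1, the entry left is the bottom one, in row n + 1, and the minor on rows 1, ..., n
      -- is again `D`.
      ≡⟨ detᶜ-last-corner n 1 {orthogonal n} (orthogonal-vanishes n) cols ⟩
    orthogonal n (suc n) * D ∎
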